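{- For every integer $t\geq 2$ there exists a $2t\times(2t+1)$ acyclic 0--1 pattern $X_t$ such that \[ \operatorname{Ex}(X_t,n)=\Omega\big(n(\log n/\log\log n)^t\big)\quad\text{and}\quad \operatorname{Ex}(X_t,n)=O\big(n\log^{4t-3} n\big). \]
   Context: For a 0--1 matrix $P\in\{0,1\}^{k\times l}$ and $A\in\{0,1\}^{n\times n}$, $A$ contains $P$ (written $P\prec A$) if there are rows $r_1<\cdots<r_k$ and columns $c_1<\cdots<c_l$ of $A$ such that $P(i,j)=1$ implies $A(r_i,c_j)=1$; otherwise $A$ avoids $P$. The extremal function is $\operatorname{Ex}(P,n)=\max\{\|A\|_1 : A\in\{0,1\}^{n\times n},\ P\nprec A\}$, where $\|A\|_1$ is the number of 1s of $A$. A pattern $P$ is acyclic if the bipartite graph whose two vertex classes are the rows and the columns of $P$, with row $i$ adjacent to column $j$ iff $P(i,j)=1$, is a forest. Asymptotics are as $n\to\infty$ with $t$ fixed. -}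

module Defs where

open import Data.Nat using (ℕ; zero; suc; _+_; _*_; _^_; _≤_)
open import Data.Fin using (Fin; zero; suc; inject₁; fromℕ; _<_)
open import Data.Bool using (Bool; true; false; if_then_else_)
open import Data.Product using (Σ; _×_; _,_)
open import Data.Nat.Logarithm using (⌊log₂_⌋)
open import Relation.Binary.PropositionalEquality using (_≡_)
open import Relation.Nullary using (¬_)
open import Function.Definitions using (Injective)

Matrix : ℕ → ℕ → Set
Matrix k l = Fin k → Fin l → Bool

Σ< : (n : ℕ) → (Fin n → ℕ) → ℕ
Σ< zero    f = 0
Σ< (suc n) f = f zero + Σ< n (λ i → f (suc i))

ones : ∀ {k l} → Matrix k l → ℕ
ones {k} {l} A = Σ< k (λ i → Σ< l (λ j → if A i j then 1 else 0))

StrictlyIncreasing : ∀ {a b} → (Fin a → Fin b) → Set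
StrictlyIncreasing {a} f = (i j : Fin a) → i < j → f i < f j

Contains : ∀ {k l m n} → Matrix k l → Matrix m n → Set
Contains {k} {l} {m} {n} P A =
  Σ (Fin k → Fin m) λ r → Σ (Fin l → Fin n) λ c →
    StrictlyIncreasing r × StrictlyIncreasing c ×
    ((i : Fin k) (j : Fin l) → P i j ≡ true → A (r i) (c j) ≡ true)

-- A cycle of length 2(m+2) in the row/column bipartite graph of P:
-- distinct rows r₀,…,r_{m+1} and distinct columns c₀,…,c_{m+1} with
-- edges r_i–c_i, c_i–r_{i+1} (i ≤ m) and c_{m+1}–r₀.
Cycle : ∀ {k l} → Matrix k l → Set
Cycle {k} {l} P =
  Σ ℕ λ m → Σ (Fin (suc (suc m)) → Fin k) λ r → Σ (Fin (suc (suc m)) → Fin l) λ c →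
    Injective _≡_ _≡_ r × Injective _≡_ _≡_ c ×
    ((i : Fin (suc (suc m))) → P (r i) (c i) ≡ true) ×
    ((i : Fin (suc m)) → P (r (suc i)) (c (inject₁ i)) ≡ true) ×
    (P (r zero) (c (fromℕ (suc m))) ≡ true)

Acyclic : ∀ {k l} → Matrix k l → Set
Acyclic P = ¬ Cycle P

-- Ex(P,n) = Ω(n (log n / log log n)^t), unfolding Ex as a maximum:
-- for large n there is an n×n P-avoiding matrix with
-- ‖A‖₁ ≥ (1/c) · n · ⌊log₂ n⌋^t / ⌊log₂ ⌊log₂ n⌋⌋^t.
ExLowerBound : ∀ {k l} → Matrix k l → ℕ → Set
ExLowerBound P t =
  Σ ℕ λ c → Σ ℕ λ N → (n : ℕ) → N ≤ n →
    Σ (Matrix n n) λ A → ¬ Contains P A ×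
      (n * ⌊log₂ n ⌋ ^ t ≤ c * ones A * ⌊log₂ ⌊log₂ n ⌋ ⌋ ^ t)

ExUpperBound : ∀ {k l} → Matrix k l → ℕ → Set
ExUpperBound P e =
  Σ ℕ λ C → Σ ℕ λ N → (n : ℕ) → N ≤ n →
    (A : Matrix n n) → ¬ Contains P A → ones A ≤ C * n * ⌊log₂ n ⌋ ^ e

{-# OPTIONS --safe #-}

-- With L = 2t − 1, the pattern has ones in row 0 at column 0 and the odd columns, in row L at the
-- even columns, in column 0 at row 0 and the odd rows, and in column L at the even rows.
--
-- Lower bound.  Attach to each tuple (k₁,…,kₜ) of digits a weight w, a sum over j of terms
-- ρ · M^e in which e is determined by j and kⱼ, and ρ encodes k₁,…,kⱼ₋₁; put a one at (x , y)
-- when x + y + w + 1 = n for some tuple.  A gap between two ones of a row, or of a column, is a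
-- difference of weights; it is close to the leading term ρ · M^e at the first index ("level")
-- where the two tuples differ, and so reveals the tuple of the first one up to that index.  In a
-- copy of the pattern the gaps of row 0 interleave with those of row L: two consecutive gaps of
-- row 0 of the same level force the corner tuples of these rows to agree beyond that level, that
-- is, the row gap has a higher level.  Symmetrically for columns.  There are only t levels, so each
-- of the outermost gaps, in row 0 and in column 0, has a higher level than the other or the lowest
-- level; that both have the lowest level is excluded by the last gap of row L.
--
-- Upper bound.  The ones at (0,0), (L,0), (L,L+1) are forced by linearly many ones.  Insert the
-- columns L,…,1 next to column 0, then the rows L−1,…,1 next to row 0.  Each insertion costs a
-- logarithm: pass to the ones whose distance to the next one lies in a fixed dyadic interval.
module Submission where

open import Defs
open import Algebra.Properties.CommutativeSemigroup using (interchange)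
open import Data.Bool using (Bool; true; false; if_then_else_; _∧_)
open import Data.Bool.Properties using () renaming (_≟_ to _≟ᵇ_)
open import Data.Empty using (⊥; ⊥-elim)
open import Data.Fin as Fin using (Fin; zero; suc; toℕ; fromℕ; fromℕ<; inject₁; remQuot)
open import Data.Fin.Properties as Fin using (toℕ<n; toℕ-injective; toℕ-fromℕ<; any?)
open import Data.Nat
open import Data.Nat.DivMod
open import Data.Nat.Logarithm
open import Data.Nat.Properties hiding (_≟_)
open import Data.Nat.Tactic.RingSolver using (solve-∀)
open import Data.Parity.Base using (0ℙ; 1ℙ)
open import Data.Parity.Properties using () renaming (_≟_ to _≟ℙ_)
open import Data.Product using (Σ; _×_; _,_; proj₁; proj₂; uncurry)
open import Data.Sum using (_⊎_; inj₁; inj₂; fromInj₁; swap)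
open import Data.Vec using (Vec; []; _∷_)
open import Data.Vec.Properties using (∷-injective)
open import Function using (flip; case_of_)
open import Function.Definitions using (Injective)
open import Relation.Binary.Definitions using (tri<; tri≈; tri>)
open import Relation.Binary.PropositionalEquality
open import Relation.Nullary using (¬_; Dec; yes; no; does; ¬?)
open import Relation.Nullary.Decidable using (_×-dec_; _⊎-dec_; dec-true)

-- The pattern

does-sound : ∀ {p} {P : Set p} (P? : Dec P) → does P? ≡ true → P
does-sound (yes p) _ = p

parity-suc-even : ∀ n → parity n ≡ 0ℙ → parity (suc n) ≡ 1ℙ
parity-suc-even zero          _    = refl
parity-suc-even (suc (suc n)) even = parity-suc-even n even

parity-suc-odd : ∀ n → parity n ≡ 1ℙ → parity (suc n) ≡ 0ℙ
parity-suc-odd (suc zero)    _   = refl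
parity-suc-odd (suc (suc n)) odd = parity-suc-odd n odd

parity-even : ∀ n → parity (n * 2) ≡ 0ℙ
parity-even zero    = refl
parity-even (suc n) = parity-even n

parity-odd : ∀ n → parity (suc (n * 2)) ≡ 1ℙ
parity-odd zero    = refl
parity-odd (suc n) = parity-odd n

Line : ℕ → ℕ → ℕ → Set
Line L i j = (i ≡ 0 × (j ≡ 0 ⊎ parity j ≡ 1ℙ)) ⊎ (i ≡ L × parity j ≡ 0ℙ)

-- The definition is symmetric in `i` and `j`, so `swap` transposes it and arguments about columns
-- also serve for rows.
Entry : ℕ → ℕ → ℕ → Set
Entry L i j = Line L i j ⊎ Line L j i

entry? : ∀ L i j → Dec (Entry L i j)
entry? L i j = line? i j ⊎-dec line? j i
  where
    line? : ∀ i j → Dec (Line L i j)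
    line? i j = ((i ≟ 0) ×-dec ((j ≟ 0) ⊎-dec (parity j ≟ℙ 1ℙ))) ⊎-dec ((i ≟ L) ×-dec (parity j ≟ℙ 0ℙ))

cross : ℕ → ∀ {k l} → Matrix k l
cross L i j = does (entry? L (toℕ i) (toℕ j))

entry-interior : ∀ {L i j} → i ≢ 0 → i ≢ L → Entry L i j →
                 (j ≡ 0 × parity i ≡ 1ℙ) ⊎ (j ≡ L × parity i ≡ 0ℙ)
entry-interior i≢0 i≢L (inj₁ (inj₁ (i≡0 , _)))        = ⊥-elim (i≢0 i≡0)
entry-interior i≢0 i≢L (inj₁ (inj₂ (i≡L , _)))        = ⊥-elim (i≢L i≡L)
entry-interior i≢0 i≢L (inj₂ (inj₁ (_ , inj₁ i≡0)))   = ⊥-elim (i≢0 i≡0)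
entry-interior i≢0 i≢L (inj₂ (inj₁ (j≡0 , inj₂ odd))) = inj₁ (j≡0 , odd)
entry-interior i≢0 i≢L (inj₂ (inj₂ j))                = inj₂ j

0ℙ≢1ℙ : ∀ {p} → p ≡ 0ℙ → p ≢ 1ℙ
0ℙ≢1ℙ refl ()

entry-top : ∀ {L j} → parity L ≡ 1ℙ → Entry L 0 j → j ≡ 0 ⊎ parity j ≡ 1ℙ
entry-top odd (inj₁ (inj₁ (_ , j)))      = j
entry-top odd (inj₁ (inj₂ (refl , _)))   = ⊥-elim (0ℙ≢1ℙ refl odd)
entry-top odd (inj₂ (inj₁ (j≡0 , _)))    = inj₁ j≡0
entry-top odd (inj₂ (inj₂ (refl , _)))   = inj₂ odd

entry-bottom : ∀ {L j} → parity L ≡ 1ℙ → Entry L L j → parity j ≡ 0ℙ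
entry-bottom odd (inj₁ (inj₁ (refl , _)))   = ⊥-elim (0ℙ≢1ℙ refl odd)
entry-bottom odd (inj₁ (inj₂ (_ , even)))   = even
entry-bottom odd (inj₂ (inj₁ (refl , _)))   = refl
entry-bottom odd (inj₂ (inj₂ (_ , even)))   = ⊥-elim (0ℙ≢1ℙ even odd)

-- A row other than 0 and `L` has at most one one, so a cycle can use rows 0 and `L` only. These
-- share column 0 alone, whereas `r zero` shares two different columns with its neighbours in the
-- cycle.
acyclic : ∀ {L k l} → parity L ≡ 1ℙ → Acyclic (cross L {k} {l})
acyclic {L} {k} {l} odd (m , r , c , r-inj , c-inj , diag , below , close) =
  0≢1 (c-inj (toℕ-injective (trans c₀≡0 (sym c₁≡0))))
  where
    last = suc m

    0≢1 : zero ≡ fromℕ last → ⊥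
    0≢1 ()

    entry : ∀ {i j} → cross L {k} {l} i j ≡ true → Entry L (toℕ i) (toℕ j)
    entry = does-sound (entry? L _ _)

    extreme : ∀ i {j j′} → j ≢ j′ → cross L {k} {l} i j ≡ true → cross L i j′ ≡ true → toℕ i ≡ 0 ⊎ toℕ i ≡ L
    extreme i j≢j′ e e′ with toℕ i ≟ 0 | toℕ i ≟ L
    ... | yes i≡0 | _       = inj₁ i≡0
    ... | no _    | yes i≡L = inj₂ i≡L
    ... | no i≢0  | no i≢L  with entry-interior i≢0 i≢L (entry e) | entry-interior i≢0 i≢L (entry e′)
    ...   | inj₁ (p , _) | inj₁ (q , _) = ⊥-elim (j≢j′ (toℕ-injective (trans p (sym q))))
    ...   | inj₂ (p , _) | inj₂ (q , _) = ⊥-elim (j≢j′ (toℕ-injective (trans p (sym q))))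
    ...   | inj₁ (_ , o) | inj₂ (_ , e) = ⊥-elim (0ℙ≢1ℙ e o)
    ...   | inj₂ (_ , e) | inj₁ (_ , o) = ⊥-elim (0ℙ≢1ℙ e o)

    extreme-suc : ∀ i → toℕ (r (suc i)) ≡ 0 ⊎ toℕ (r (suc i)) ≡ L
    extreme-suc i = extreme (r (suc i)) (λ eq → suc≢inject₁ i (c-inj eq)) (diag (suc i)) (below i)
      where
        suc≢inject₁ : ∀ {n} (i : Fin n) → suc i ≢ inject₁ i
        suc≢inject₁ i eq = 1+n≢n (trans (cong toℕ eq) (Fin.toℕ-inject₁ i))

    extreme-zero : toℕ (r zero) ≡ 0 ⊎ toℕ (r zero) ≡ L
    extreme-zero = extreme (r zero) (λ eq → 0≢1 (c-inj eq)) (diag zero) close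

    common : ∀ {i i′ j} → i ≢ i′ → toℕ i ≡ 0 ⊎ toℕ i ≡ L → toℕ i′ ≡ 0 ⊎ toℕ i′ ≡ L →
             cross L {k} {l} i j ≡ true → cross L i′ j ≡ true → toℕ j ≡ 0
    common i≢i′ (inj₁ p) (inj₁ q) e e′ = ⊥-elim (i≢i′ (toℕ-injective (trans p (sym q))))
    common i≢i′ (inj₂ p) (inj₂ q) e e′ = ⊥-elim (i≢i′ (toℕ-injective (trans p (sym q))))
    common {j = j} i≢i′ (inj₁ p) (inj₂ q) e e′ =
      fromInj₁ (λ o → ⊥-elim (0ℙ≢1ℙ even o)) (entry-top odd (subst (λ i → Entry L i (toℕ j)) p (entry e)))
      where even = entry-bottom odd (subst (λ i → Entry L i (toℕ j)) q (entry e′))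
    common i≢i′ (inj₂ p) (inj₁ q) e e′ = common (λ eq → i≢i′ (sym eq)) (inj₁ q) (inj₂ p) e′ e

    c₀≡0 : toℕ (c zero) ≡ 0
    c₀≡0 = common (λ eq → Fin.0≢1+n (r-inj eq)) extreme-zero (extreme-suc zero) (diag zero) (below zero)

    c₁≡0 : toℕ (c (fromℕ last)) ≡ 0
    c₁≡0 = common (λ eq → 0≢1 (r-inj eq)) extreme-zero (extreme-suc (fromℕ m)) close (diag (fromℕ last))

-- Weights of tuples and the levels of their gaps

module Weights (b M : ℕ) .{{M≢0 : NonZero M}} where

  -- Position by position the exponents fill disjoint blocks of length `b`, the earliest digit
  -- taking the highest block. The coefficient is the base-`b` numeral of the digits already read,
  -- preceded by the initial `ρ`.
  weight : ∀ {m} → ℕ → Vec (Fin b) m → ℕ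
  weight ρ [] = 0
  weight {suc m} ρ (k ∷ ks) = ρ * M ^ (m * b + toℕ k) + weight (ρ * b + toℕ k) ks

  exponent : ∀ {m} → Vec (Fin b) m → Fin m → ℕ
  exponent {suc m} (k ∷ ks) zero    = m * b + toℕ k
  exponent {suc m} (k ∷ ks) (suc a) = exponent ks a

  coeff : ∀ {m} → ℕ → Vec (Fin b) m → Fin m → ℕ
  coeff ρ (k ∷ ks) zero    = ρ
  coeff ρ (k ∷ ks) (suc a) = coeff (ρ * b + toℕ k) ks a

  lcp : ∀ {m} → Vec (Fin b) m → Vec (Fin b) m → ℕ
  lcp []       []       = 0
  lcp (k ∷ ks) (l ∷ ls) with k Fin.≟ l
  ... | yes _ = suc (lcp ks ls)
  ... | no  _ = 0

  -- Keeps all leading coefficients below M / 2 when m more digits are appended to ρ.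
  record Fits (m ρ : ℕ) : Set where
    constructor fits-in
    field room : 2 * (suc ρ * b ^ m) ≤ M

  -- This is |d - ρ M^e| < M^e / 2, freed of subtraction and division. For `1 ≤ ρ` and `2ρ + 1 ≤ M`
  -- the ranges belonging to different pairs `(e , ρ)` are disjoint and ordered lexicographically.
  record Near (e ρ d : ℕ) : Set where
    constructor _,_
    field
      above : 2 * (ρ * M ^ e) < 2 * d + M ^ e
      below : 2 * d < 2 * (ρ * M ^ e) + M ^ e

  push : ∀ ρ (k : Fin b) → suc (ρ * b + toℕ k) ≤ suc ρ * b
  push ρ k = begin
    suc (ρ * b + toℕ k) ≡⟨ +-suc (ρ * b) (toℕ k) ⟨
    ρ * b + suc (toℕ k) ≤⟨ +-monoʳ-≤ (ρ * b) (toℕ<n k) ⟩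
    ρ * b + b           ≡⟨ +-comm (ρ * b) b ⟩
    suc ρ * b           ∎ where open ≤-Reasoning

  fits-push : ∀ {m ρ} (k : Fin b) → Fits (suc m) ρ → Fits m (ρ * b + toℕ k)
  fits-push {m} {ρ} k (fits-in room) = fits-in (begin
    2 * (suc (ρ * b + toℕ k) * b ^ m) ≤⟨ *-monoʳ-≤ 2 (*-monoˡ-≤ (b ^ m) (push ρ k)) ⟩
    2 * (suc ρ * b * b ^ m)           ≡⟨ cong (2 *_) (*-assoc (suc ρ) b (b ^ m)) ⟩
    2 * (suc ρ * b ^ suc m)           ≤⟨ room ⟩
    M                                 ∎) where open ≤-Reasoning

  fits-bound : ∀ {m ρ} → Fin b → Fits m ρ → suc (2 * ρ) ≤ M
  fits-bound {m} {ρ} k (fits-in room) = begin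
    suc (2 * ρ)           ≤⟨ n≤1+n _ ⟩
    suc (suc (2 * ρ))     ≡⟨ solve-ρ ρ ⟩
    2 * (suc ρ * 1)       ≤⟨ *-monoʳ-≤ 2 (*-monoʳ-≤ (suc ρ) (m^n>0 b {{b≢0}} m)) ⟩
    2 * (suc ρ * b ^ m)   ≤⟨ room ⟩
    M                     ∎
    where
      open ≤-Reasoning
      b≢0 : NonZero b
      b≢0 = Fin.nonZeroIndex k
      solve-ρ : ∀ ρ → suc (suc (2 * ρ)) ≡ 2 * (suc ρ * 1)
      solve-ρ = solve-∀

  push≥1 : ∀ {ρ} → 1 ≤ ρ → (k : Fin b) → 1 ≤ ρ * b + toℕ k
  push≥1 {ρ} 1≤ρ k =
    ≤-trans (*-mono-≤ 1≤ρ (≤-trans (s≤s z≤n) (toℕ<n k))) (m≤m+n (ρ * b) (toℕ k))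

  mutual
    weight-tail : ∀ {m ρ} (ks : Vec (Fin b) m) → Fits m ρ → 2 * weight ρ ks < M ^ (m * b)
    weight-tail             []       fits = s≤s z≤n
    weight-tail {suc m} {ρ} (k ∷ ks) fits =
      subst (λ e → 2 * weight ρ (k ∷ ks) < M ^ e) (+-comm (m * b) b) (weight-head k ks b (toℕ<n k) fits)

    -- The terms after the first sum to less than half of the leading power, and `2ρ + 1 ≤ M`
    -- absorbs the first one. The bound `K` is free: `K = b` serves the recursion, and the first
    -- digit of another tuple serves the comparison of two weights.
    weight-head : ∀ {m ρ} (k : Fin b) (ks : Vec (Fin b) m) K → toℕ k < K → Fits (suc m) ρ →
                  2 * weight ρ (k ∷ ks) < M ^ (m * b + K)
    weight-head {m} {ρ} k ks K k<K fits = begin-strict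
      2 * (ρ * P + v)             ≡⟨ *-distribˡ-+ 2 (ρ * P) v ⟩
      2 * (ρ * P) + 2 * v         <⟨ +-monoʳ-< (2 * (ρ * P)) (weight-tail ks (fits-push k fits)) ⟩
      2 * (ρ * P) + M ^ (m * b)   ≤⟨ +-monoʳ-≤ (2 * (ρ * P)) (^-monoʳ-≤ M (m≤m+n (m * b) (toℕ k))) ⟩
      2 * (ρ * P) + P             ≡⟨ collect ρ P ⟩
      suc (2 * ρ) * P             ≤⟨ *-monoˡ-≤ P (fits-bound {suc m} {ρ} k fits) ⟩
      M ^ suc (m * b + toℕ k)     ≤⟨ ^-monoʳ-≤ M (≤-trans (≤-reflexive (sym (+-suc (m * b) (toℕ k)))) (+-monoʳ-≤ (m * b) k<K)) ⟩
      M ^ (m * b + K)             ∎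
      where
        open ≤-Reasoning
        P = M ^ (m * b + toℕ k)
        v = weight (ρ * b + toℕ k) ks
        collect : ∀ ρ P → 2 * (ρ * P) + P ≡ suc (2 * ρ) * P
        collect = solve-∀

  weight-lead : ∀ {m ρ} (k : Fin b) (ks : Vec (Fin b) m) → 1 ≤ ρ → Fits (suc m) ρ →
              M ^ (m * b + toℕ k) ≤ weight ρ (k ∷ ks)
  weight-lead {m} {ρ} k ks 1≤ρ fits = begin
    P                  ≡⟨ *-identityˡ P ⟨
    1 * P              ≤⟨ *-monoˡ-≤ P 1≤ρ ⟩
    ρ * P              ≤⟨ m≤m+n (ρ * P) _ ⟩
    weight ρ (k ∷ ks)  ∎
    where
      open ≤-Reasoning
      P = M ^ (m * b + toℕ k)

  weight-mono : ∀ {m ρ} {k l : Fin b} (ks ls : Vec (Fin b) m) → 1 ≤ ρ → Fits (suc m) ρ →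
                toℕ k < toℕ l → weight ρ (k ∷ ks) < weight ρ (l ∷ ls)
  weight-mono {m} {ρ} {k} {l} ks ls 1≤ρ fits k<l = begin-strict
    weight ρ (k ∷ ks)      ≤⟨ m≤m+n _ _ ⟩
    2 * weight ρ (k ∷ ks)  <⟨ weight-head k ks (toℕ l) k<l fits ⟩
    M ^ (m * b + toℕ l)    ≤⟨ weight-lead l ls 1≤ρ fits ⟩
    weight ρ (l ∷ ls)      ∎
    where open ≤-Reasoning

  weight-injective : ∀ {m ρ} (ks ls : Vec (Fin b) m) → 1 ≤ ρ → Fits m ρ →
                     weight ρ ks ≡ weight ρ ls → ks ≡ ls
  weight-injective [] [] _ _ _ = refl
  weight-injective {suc m} {ρ} (k ∷ ks) (l ∷ ls) 1≤ρ fits eq with <-cmp (toℕ k) (toℕ l)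
  ... | tri< k<l _ _ = ⊥-elim (<⇒≢ (weight-mono ks ls 1≤ρ fits k<l) eq)
  ... | tri> _ _ l<k = ⊥-elim (<⇒≢ (weight-mono ls ks 1≤ρ fits l<k) (sym eq))
  ... | tri≈ _ k≡l _ with refl ← toℕ-injective k≡l =
    cong (k ∷_) (weight-injective ks ls (push≥1 1≤ρ k) (fits-push k fits)
      (+-cancelˡ-≡ (ρ * M ^ (m * b + toℕ k)) _ _ eq))

  exponent-upper : ∀ {m} (ks : Vec (Fin b) m) a → exponent ks a < m * b
  exponent-upper {suc m} (k ∷ ks) zero    =
    <-≤-trans (+-monoʳ-< (m * b) (toℕ<n k)) (≤-reflexive (+-comm (m * b) b))
  exponent-upper {suc m} (k ∷ ks) (suc a) = <-≤-trans (exponent-upper ks a) (m≤n+m (m * b) b)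

  exponent-antitone : ∀ {m} (ks ls : Vec (Fin b) m) {a a′} → toℕ a < toℕ a′ →
                      exponent ls a′ < exponent ks a
  exponent-antitone {suc m} (k ∷ ks) (l ∷ ls) {zero}  {suc a′} _         =
    <-≤-trans (exponent-upper ls a′) (m≤m+n (m * b) (toℕ k))
  exponent-antitone         (k ∷ ks) (l ∷ ls) {suc a} {suc a′} (s≤s a<a′) =
    exponent-antitone ks ls a<a′

  coeff≥1 : ∀ {m ρ} (ks : Vec (Fin b) m) a → 1 ≤ ρ → 1 ≤ coeff ρ ks a
  coeff≥1 (k ∷ ks) zero    1≤ρ = 1≤ρ
  coeff≥1 (k ∷ ks) (suc a) 1≤ρ = coeff≥1 ks a (push≥1 1≤ρ k)

  coeff-bound : ∀ {m ρ} (ks : Vec (Fin b) m) a → Fits m ρ → suc (2 * coeff ρ ks a) ≤ M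
  coeff-bound {suc m} {ρ} (k ∷ ks) zero    fits = fits-bound {suc m} {ρ} k fits
  coeff-bound             (k ∷ ks) (suc a) fits = coeff-bound ks a (fits-push k fits)

  push-injective : ∀ ρ σ (k l : Fin b) → ρ * b + toℕ k ≡ σ * b + toℕ l → ρ ≡ σ × k ≡ l
  push-injective ρ σ k l eq with <-cmp ρ σ
  ... | tri< ρ<σ _ _ = ⊥-elim (<⇒≢ (<-≤-trans (push ρ k)
                         (≤-trans (*-monoˡ-≤ b ρ<σ) (m≤m+n (σ * b) (toℕ l)))) eq)
  ... | tri> _ _ σ<ρ = ⊥-elim (<⇒≢ (<-≤-trans (push σ l)
                         (≤-trans (*-monoˡ-≤ b σ<ρ) (m≤m+n (ρ * b) (toℕ k)))) (sym eq))
  ... | tri≈ _ refl _ = refl , toℕ-injective (+-cancelˡ-≡ (ρ * b) _ _ eq)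

  lcp-∷ : ∀ {m} (k : Fin b) (ks ls : Vec (Fin b) m) → lcp (k ∷ ks) (k ∷ ls) ≡ suc (lcp ks ls)
  lcp-∷ k ks ls with k Fin.≟ k
  ... | yes _  = refl
  ... | no k≢k = ⊥-elim (k≢k refl)

  lcp-≢ : ∀ {m} {k l : Fin b} (ks ls : Vec (Fin b) m) → k ≢ l → lcp (k ∷ ks) (l ∷ ls) ≡ 0
  lcp-≢ {k = k} {l} ks ls k≢l with k Fin.≟ l
  ... | yes k≡l = ⊥-elim (k≢l k≡l)
  ... | no  _   = refl

  -- The exponent of a term gives its position and its digit; stripping digits off the coefficient
  -- then gives the earlier ones. The initial `ρ` and `σ` are kept apart because their equality is
  -- what the induction hands back from the deeper position.
  place-injective : ∀ {m ρ σ} (ks ls : Vec (Fin b) m) {a a′} →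
                    exponent ks a ≡ exponent ls a′ → coeff ρ ks a ≡ coeff σ ls a′ →
                    ρ ≡ σ × toℕ a < lcp ks ls
  place-injective {suc m} (k ∷ ks) (l ∷ ls) {zero} {zero} e≡ c≡
    with refl ← toℕ-injective (+-cancelˡ-≡ (m * b) (toℕ k) (toℕ l) e≡) =
    c≡ , subst (1 ≤_) (sym (lcp-∷ k ks ls)) (s≤s z≤n)
  place-injective {suc m} (k ∷ ks) (l ∷ ls) {zero} {suc a′} e≡ c≡ =
    ⊥-elim (<⇒≢ (<-≤-trans (exponent-upper ls a′) (m≤m+n (m * b) (toℕ k))) (sym e≡))
  place-injective {suc m} (k ∷ ks) (l ∷ ls) {suc a} {zero} e≡ c≡ =
    ⊥-elim (<⇒≢ (<-≤-trans (exponent-upper ks a) (m≤m+n (m * b) (toℕ l))) e≡)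
  place-injective {suc m} {ρ} {σ} (k ∷ ks) (l ∷ ls) {suc a} {suc a′} e≡ c≡
    with place-injective ks ls e≡ c≡
  ... | push≡ , a<lcp with push-injective ρ σ k l push≡
  ... | ρ≡σ , refl = ρ≡σ , subst (suc (toℕ a) <_) (sym (lcp-∷ k ks ls)) (s≤s a<lcp)

  near-exponent-< : ∀ {e f ρ σ g h} → suc (2 * ρ) ≤ M → 1 ≤ σ → e < f →
                    Near e ρ g → Near f σ h → g < h
  near-exponent-< {e} {f} {ρ} {σ} {g} {h} ρ-bound 1≤σ e<f (_ , g<) (h> , _) =
    *-cancelˡ-< 2 g h (begin-strict
      2 * g                    <⟨ g< ⟩
      2 * (ρ * M ^ e) + M ^ e  ≡⟨ collect ρ (M ^ e) ⟩
      suc (2 * ρ) * M ^ e      ≤⟨ *-monoˡ-≤ (M ^ e) ρ-bound ⟩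
      M ^ suc e                ≤⟨ ^-monoʳ-≤ M e<f ⟩
      M ^ f                    <⟨ +-cancelʳ-< (M ^ f) (M ^ f) (2 * h) half ⟩
      2 * h                    ∎)
    where
      open ≤-Reasoning
      collect : ∀ ρ P → 2 * (ρ * P) + P ≡ suc (2 * ρ) * P
      collect = solve-∀
      double : ∀ P → P + P ≡ 2 * (1 * P)
      double = solve-∀
      half : M ^ f + M ^ f < 2 * h + M ^ f
      half = begin-strict
        M ^ f + M ^ f    ≡⟨ double (M ^ f) ⟩
        2 * (1 * M ^ f)  ≤⟨ *-monoʳ-≤ 2 (*-monoˡ-≤ (M ^ f) 1≤σ) ⟩
        2 * (σ * M ^ f)  <⟨ h> ⟩
        2 * h + M ^ f    ∎

  near-coeff-< : ∀ {e ρ σ g h} → ρ < σ → Near e ρ g → Near e σ h → g < h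
  near-coeff-< {e} {ρ} {σ} {g} {h} ρ<σ (_ , g<) (h> , _) =
    *-cancelˡ-< 2 g h (<-trans g< (+-cancelʳ-< (M ^ e) _ (2 * h) (begin-strict
      2 * (ρ * M ^ e) + M ^ e + M ^ e  ≡⟨ collect ρ (M ^ e) ⟩
      2 * (suc ρ * M ^ e)              ≤⟨ *-monoʳ-≤ 2 (*-monoˡ-≤ (M ^ e) ρ<σ) ⟩
      2 * (σ * M ^ e)                  <⟨ h> ⟩
      2 * h + M ^ e                    ∎)))
    where
      open ≤-Reasoning
      collect : ∀ ρ P → 2 * (ρ * P) + P + P ≡ 2 * (suc ρ * P)
      collect = solve-∀

  -- The common prefix cancels. At the first difference `ks` has the larger digit, and the gap is
  -- its leading term plus the tail of `ks` minus all that is left of `ls`; these two corrections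
  -- have opposite signs and are each below half the leading power. The last clause is for
  -- `both-top`.
  near-gap : ∀ {m ρ} (ks ls : Vec (Fin b) m) d → 1 ≤ ρ → Fits m ρ →
             weight ρ ks ≡ weight ρ ls + suc d →
             Σ (Fin m) λ a → toℕ a ≡ lcp ks ls ×
               Near (exponent ks a) (coeff ρ ks a) (suc d) ×
               (∀ a′ → toℕ a ≤ toℕ a′ → exponent ls a′ < exponent ks a)
  near-gap [] [] d _ _ ()
  near-gap {suc m} {ρ} (k ∷ ks) (l ∷ ls) d 1≤ρ fits eq with <-cmp (toℕ k) (toℕ l)
  ... | tri< k<l _ _ = ⊥-elim (<-asym (weight-mono ks ls 1≤ρ fits k<l)
                         (≤-trans (s≤s (m≤m+n _ d)) (≤-reflexive (trans (sym (+-suc _ d)) (sym eq)))))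
  ... | tri≈ _ k≡l _ with refl ← toℕ-injective k≡l
      with near-gap ks ls d (push≥1 1≤ρ k) (fits-push k fits)
             (+-cancelˡ-≡ (ρ * M ^ (m * b + toℕ k)) _ _ (trans eq (+-assoc (ρ * M ^ (m * b + toℕ k)) _ _)))
  ...   | a , a≡ , near , below =
          suc a , trans (cong suc a≡) (sym (lcp-∷ k ks ls)) , near ,
          λ { zero () ; (suc a′) (s≤s a≤a′) → below a′ a≤a′ }
  near-gap {suc m} {ρ} (k ∷ ks) (l ∷ ls) d 1≤ρ fits eq | tri> _ _ l<k =
    zero , sym (lcp-≢ ks ls λ { refl → <-irrefl refl l<k }) , (lower , upper) , below
    where
      open ≤-Reasoning
      P = M ^ (m * b + toℕ k)
      v = weight (ρ * b + toℕ k) ks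
      u = weight ρ (l ∷ ls)
      lower : 2 * (ρ * P) < 2 * suc d + P
      lower = begin-strict
        2 * (ρ * P)          ≤⟨ *-monoʳ-≤ 2 (m≤m+n (ρ * P) v) ⟩
        2 * (ρ * P + v)      ≡⟨ cong (2 *_) (trans eq (+-comm u (suc d))) ⟩
        2 * (suc d + u)      ≡⟨ *-distribˡ-+ 2 (suc d) u ⟩
        2 * suc d + 2 * u    <⟨ +-monoʳ-< (2 * suc d) (weight-head l ls (toℕ k) l<k fits) ⟩
        2 * suc d + P        ∎
      upper : 2 * suc d < 2 * (ρ * P) + P
      upper = begin-strict
        2 * suc d                  ≤⟨ *-monoʳ-≤ 2 (m≤n+m (suc d) u) ⟩
        2 * (u + suc d)            ≡⟨ cong (2 *_) eq ⟨
        2 * (ρ * P + v)            ≡⟨ *-distribˡ-+ 2 (ρ * P) v ⟩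
        2 * (ρ * P) + 2 * v        <⟨ +-monoʳ-< (2 * (ρ * P)) (weight-tail ks (fits-push k fits)) ⟩
        2 * (ρ * P) + M ^ (m * b)  ≤⟨ +-monoʳ-≤ (2 * (ρ * P)) (^-monoʳ-≤ M (m≤m+n (m * b) (toℕ k))) ⟩
        2 * (ρ * P) + P            ∎
      below : ∀ a′ → 0 ≤ toℕ a′ → exponent (l ∷ ls) a′ < m * b + toℕ k
      below zero     _ = +-monoʳ-< (m * b) l<k
      below (suc a′) _ = <-≤-trans (exponent-upper ls a′) (m≤m+n (m * b) (toℕ k))

  near-sandwich : ∀ {e f ρ σ g h g′} →
                  1 ≤ ρ → suc (2 * ρ) ≤ M → 1 ≤ σ → suc (2 * σ) ≤ M →
                  Near e ρ g → Near f σ h → Near e ρ g′ → g < h → h < g′ → e ≡ f × ρ ≡ σ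
  near-sandwich {e} {f} {ρ} {σ} 1≤ρ ρ-bound 1≤σ σ-bound g≈ h≈ g′≈ g<h h<g′ with <-cmp e f
  ... | tri< e<f _ _ = ⊥-elim (<-asym h<g′ (near-exponent-< ρ-bound 1≤σ e<f g′≈ h≈))
  ... | tri> _ _ f<e = ⊥-elim (<-asym g<h (near-exponent-< σ-bound 1≤ρ f<e h≈ g≈))
  ... | tri≈ _ refl _ with <-cmp ρ σ
  ...   | tri< ρ<σ _ _ = ⊥-elim (<-asym h<g′ (near-coeff-< ρ<σ g′≈ h≈))
  ...   | tri≈ _ ρ≡σ _ = refl , ρ≡σ
  ...   | tri> _ _ σ<ρ = ⊥-elim (<-asym g<h (near-coeff-< σ<ρ h≈ g≈))

  record Level {m} (ks ls : Vec (Fin b) m) (d : ℕ) : Set where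
    field
      level  : Fin m
      is-lcp : toℕ level ≡ lcp ks ls
      near   : Near (exponent ks level) (coeff 1 ks level) d
      below  : ∀ a → toℕ level ≤ toℕ a → exponent ls a < exponent ks level

  open Level

  module _ {m} (fits : Fits m 1) where

    gap-level : ∀ ks ls {d} → 0 < d → weight 1 ks ≡ weight 1 ls + d → Level ks ls d
    gap-level ks ls {suc d} _ eq with near-gap ks ls d ≤-refl fits eq
    ... | a , is-lcp , near , below = record { level = a ; is-lcp = is-lcp ; near = near ; below = below }

    level-antitone : ∀ {ks ls ls′ d d′} (g : Level ks ls d) (g′ : Level ks ls′ d′) →
                     d < d′ → toℕ (level g′) ≤ toℕ (level g)
    level-antitone {ks} g g′ d<d′ = ≮⇒≥ λ l<l′ →
      <-asym d<d′ (near-exponent-< (coeff-bound ks (level g′) fits) (coeff≥1 ks (level g) ≤-refl)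
        (exponent-antitone ks ks l<l′) (near g′) (near g))

    -- `d` and `d′` are near the same term of `ks`. Since `e` lies between them and is near a term
    -- of `ms`, the two terms coincide, and `place-injective` applies.
    level-sandwich : ∀ {ks ls ls′ ms ns d e d′} (g : Level ks ls d) → Level ms ns e → (g′ : Level ks ls′ d′) →
                     toℕ (level g) ≡ toℕ (level g′) → d < e → e < d′ → toℕ (level g) < lcp ks ms
    level-sandwich {ks} {ms = ms} g h g′ same d<e e<d′
      with refl ← toℕ-injective {i = level g} {level g′} same =
      let e≡ , c≡ = near-sandwich (coeff≥1 ks (level g) ≤-refl) (coeff-bound ks (level g) fits)
                                  (coeff≥1 ms (level h) ≤-refl) (coeff-bound ms (level h) fits)
                                  (near g) (near h) (near g′) d<e e<d′
      in proj₂ (place-injective ks ms e≡ c≡)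

    -- Gaps d 0 < e 0 < d 1 < e 1 < ... seen alternately from ks and from ms: the levels of the d i
    -- descend strictly until one is repeated, and a repetition makes ms agree with ks past that level.
    fan : ∀ {q} (ks ms : Vec (Fin b) m) (d e : ℕ → ℕ) (u v : ℕ → Vec (Fin b) m) → 0 < d 0 →
          (∀ i → i ≤ q → weight 1 ks ≡ weight 1 (u i) + d i) →
          (∀ i → i < q → weight 1 ms ≡ weight 1 (v i) + e i) →
          (∀ i → i < q → d i < e i) → (∀ i → i < q → e i < d (suc i)) →
          ∀ i → i ≤ q → Σ (Level ks (u i) (d i)) λ g →
            toℕ (level g) < lcp ks ms ⊎ toℕ (level g) + i < m
    fan {q} ks ms d e u v 0<d ks-gap ms-gap d<e e<d = go
      where
        go : ∀ i → i ≤ q → Σ (Level ks (u i) (d i)) λ g →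
               toℕ (level g) < lcp ks ms ⊎ toℕ (level g) + i < m
        go zero 0≤q = g , inj₂ (subst (_< m) (sym (+-identityʳ _)) (toℕ<n (level g)))
          where g = gap-level ks (u 0) 0<d (ks-gap 0 0≤q)
        go (suc i) i<q = g′ , next (proj₂ (go i (<⇒≤ i<q)))
          where
            g = proj₁ (go i (<⇒≤ i<q))
            h = gap-level ms (v i) (≤-<-trans z≤n (d<e i i<q)) (ms-gap i i<q)
            g′ = gap-level ks (u (suc i)) (≤-<-trans z≤n (e<d i i<q)) (ks-gap (suc i) i<q)
            desc = level-antitone g g′ (<-trans (d<e i i<q) (e<d i i<q))
            next : toℕ (level g) < lcp ks ms ⊎ toℕ (level g) + i < m →
                   toℕ (level g′) < lcp ks ms ⊎ toℕ (level g′) + suc i < m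
            next (inj₁ l<lcp) = inj₁ (≤-<-trans desc l<lcp)
            next (inj₂ l+i<m) with m≤n⇒m<n∨m≡n desc
            ... | inj₁ l′<l = inj₂ (≤-trans (s≤s (≤-trans (≤-reflexive (+-suc _ i)) (+-monoˡ-≤ i l′<l))) l+i<m)
            ... | inj₂ l′≡l = inj₁ (subst (_< lcp ks ms) (sym l′≡l)
                                (level-sandwich g h g′ (sym l′≡l) (d<e i i<q) (e<d i i<q)))

  gap-equation : ∀ {n a y y′ w w′} → y < y′ → a + y + suc w ≡ n → a + y′ + suc w′ ≡ n →
                 w ≡ w′ + (y′ ∸ y)
  gap-equation {n} {a} {y} {y′} {w} {w′} y<y′ eq eq′ =
    suc-injective (+-cancelˡ-≡ (a + y) _ _ (begin
      a + y + suc w                   ≡⟨ trans eq (sym eq′) ⟩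
      a + y′ + suc w′                 ≡⟨ cong (λ z → a + z + suc w′) (m+[n∸m]≡n (<⇒≤ y<y′)) ⟨
      a + (y + (y′ ∸ y)) + suc w′     ≡⟨ shuffle a y (y′ ∸ y) w′ ⟩
      a + y + suc (w′ + (y′ ∸ y))     ∎))
    where
      open ≡-Reasoning
      shuffle : ∀ a y g w → a + (y + g) + suc w ≡ a + y + suc (w + g)
      shuffle = solve-∀

  -- With `L = 1 + 2q`, the outermost gap of row 0 leads from the tuple of (0,0) to that of (0,L),
  -- and the outermost gap of column 0 leads to that of (L,0). So the common prefix in the result of
  -- either `fan` has as its length the level of the outermost gap in the other.
  no-cross : ∀ q → Fits (suc q) 1 → ∀ n (x y : ℕ → ℕ) (κ : ℕ → ℕ → Vec (Fin b) (suc q)) →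
             (∀ {i j} → i < j → j < 2 + q * 2 → x i < x j) →
             (∀ {i j} → i < j → j < 3 + q * 2 → y i < y j) →
             (∀ i j → i < 2 + q * 2 → j < 3 + q * 2 → Entry (suc (q * 2)) i j →
                      x i + y j + suc (weight 1 (κ i j)) ≡ n) → ⊥
  no-cross q fits n x y κ x< y< edge = clash (proj₂ row) (proj₂ col)
    where
      L = suc (q * 2)
      ks = κ 0 0

      ≤2q : ∀ {i} → i ≤ q → i * 2 ≤ q * 2
      ≤2q = *-monoˡ-≤ 2

      top-edge = λ i i≤q → edge 0 (suc (i * 2)) (s≤s z≤n) (s≤s (s≤s (m≤n⇒m≤1+n (≤2q i≤q))))
                            (inj₁ (inj₁ (refl , inj₂ (parity-odd i))))
      bottom-edge = λ i i≤q → edge L (suc (suc (i * 2))) ≤-refl (s≤s (s≤s (s≤s (≤2q i≤q))))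
                               (inj₁ (inj₂ (refl , parity-even i)))
      left-edge = λ i i≤q → edge (suc (i * 2)) 0 (s≤s (s≤s (≤2q i≤q))) (s≤s z≤n)
                             (inj₂ (inj₁ (refl , inj₂ (parity-odd i))))
      right-edge = λ i i<q → edge (suc (suc (i * 2))) L (s≤s (s≤s (<⇒≤ (≤2q i<q)))) (n≤1+n _)
                              (inj₂ (inj₂ (refl , parity-even i)))
      corner = edge 0 0 (s≤s z≤n) (s≤s z≤n) (inj₁ (inj₁ (refl , inj₁ refl)))

      y-gap = λ {i j} (i<j : i < j) j< →
        ∸-monoˡ-< {n = y 0} (y< {suc i} {suc j} (s≤s i<j) j<)
                          (<⇒≤ (y< (s≤s z≤n) (<-trans (s≤s i<j) j<)))
      x-gap = λ {i j} (i<j : i < j) j< →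
        ∸-monoˡ-< {n = x 0} (x< {suc i} {suc j} (s≤s i<j) j<)
                          (<⇒≤ (x< (s≤s z≤n) (<-trans (s≤s i<j) j<)))

      row-gap : ∀ {i j j′} → j < j′ → j′ < 3 + q * 2 →
                x i + y j + suc (weight 1 (κ i j)) ≡ n → x i + y j′ + suc (weight 1 (κ i j′)) ≡ n →
                weight 1 (κ i j) ≡ weight 1 (κ i j′) + (y j′ ∸ y j)
      row-gap {i} j<j′ j′< = gap-equation {a = x i} (y< j<j′ j′<)

      col-gap : ∀ {i i′ j} → i < i′ → i′ < 2 + q * 2 →
                x i + y j + suc (weight 1 (κ i j)) ≡ n → x i′ + y j + suc (weight 1 (κ i′ j)) ≡ n →
                weight 1 (κ i j) ≡ weight 1 (κ i′ j) + (x i′ ∸ x i)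
      col-gap {i} {i′} {j} i<i′ i′< eq eq′ = gap-equation {a = y j} (x< i<i′ i′<)
        (trans (cong (λ z → z + suc (weight 1 (κ i j))) (+-comm (y j) (x i))) eq)
        (trans (cong (λ z → z + suc (weight 1 (κ i′ j))) (+-comm (y j) (x i′))) eq′)

      -- The range includes `i = q`, one gap more than `fan` uses; `both-top` needs the last one.
      bot : ∀ i → i ≤ q → weight 1 (κ L 0) ≡ weight 1 (κ L (suc (suc (i * 2)))) + (y (suc (suc (i * 2))) ∸ y 0)
      bot i i≤q = row-gap (s≤s z≤n) (s≤s (s≤s (s≤s (≤2q i≤q)))) (left-edge q ≤-refl) (bottom-edge i i≤q)

      row = fan fits {q} ks (κ L 0) (λ i → y (suc (i * 2)) ∸ y 0) (λ i → y (suc (suc (i * 2))) ∸ y 0)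
              (λ i → κ 0 (suc (i * 2))) (λ i → κ L (suc (suc (i * 2))))
              (m<n⇒0<n∸m (y< (s≤s z≤n) (s≤s (s≤s z≤n))))
              (λ i i≤q → row-gap (s≤s z≤n) (s≤s (s≤s (m≤n⇒m≤1+n (≤2q i≤q)))) corner (top-edge i i≤q))
              (λ i i<q → bot i (<⇒≤ i<q))
              (λ i i<q → y-gap ≤-refl (s≤s (s≤s (s≤s (≤2q (<⇒≤ i<q))))))
              (λ i i<q → y-gap ≤-refl (s≤s (s≤s (m≤n⇒m≤1+n (≤2q i<q)))))
              q ≤-refl
      col = fan fits {q} ks (κ 0 L) (λ i → x (suc (i * 2)) ∸ x 0) (λ i → x (suc (suc (i * 2))) ∸ x 0)
              (λ i → κ (suc (i * 2)) 0) (λ i → κ (suc (suc (i * 2))) L)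
              (m<n⇒0<n∸m (x< (s≤s z≤n) (s≤s (s≤s z≤n))))
              (λ i i≤q → col-gap (s≤s z≤n) (s≤s (s≤s (≤2q i≤q))) corner (left-edge i i≤q))
              (λ i i<q → col-gap (s≤s z≤n) (s≤s (s≤s (<⇒≤ (≤2q i<q)))) (top-edge q ≤-refl) (right-edge i i<q))
              (λ i i<q → x-gap ≤-refl (s≤s (s≤s (<⇒≤ (≤2q i<q)))))
              (λ i i<q → x-gap ≤-refl (s≤s (s≤s (≤2q i<q))))
              q ≤-refl

      g = proj₁ row
      h = proj₁ col

      vanish : ∀ {a} → a + q < suc q → a ≡ 0
      vanish {zero}  _           = refl
      vanish {suc a} (s≤s a+q<q) = ⊥-elim (<-irrefl refl (≤-<-trans (m≤n+m q a) a+q<q))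

      -- At level 0 the column gap shows that every exponent of `κ L 0` is below the leading one of
      -- `ks`. The last gap of row `L` would then be shorter than that of row 0, though it ends in a
      -- later column.
      both-top : toℕ (level g) ≡ 0 → toℕ (level h) ≡ 0 → ⊥
      both-top g≡0 h≡0 = <-asym (y-gap ≤-refl ≤-refl)
        (near-exponent-< (coeff-bound (κ L 0) (level z) fits) (coeff≥1 ks (level g) ≤-refl)
          (subst (λ a → exponent (κ L 0) (level z) < exponent ks a)
            (toℕ-injective {i = level h} (trans h≡0 (sym g≡0)))
            (below h (level z) (subst (_≤ toℕ (level z)) (sym h≡0) z≤n)))
          (near z) (near g))
        where
          z = gap-level fits (κ L 0) (κ L (suc (suc (q * 2)))) (m<n⇒0<n∸m (y< (s≤s z≤n) ≤-refl)) (bot q ≤-refl)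

      clash : toℕ (level g) < lcp ks (κ L 0) ⊎ toℕ (level g) + q < suc q →
              toℕ (level h) < lcp ks (κ 0 L) ⊎ toℕ (level h) + q < suc q → ⊥
      clash (inj₁ g<) (inj₁ h<) = <-asym (<-≤-trans g< (≤-reflexive (sym (is-lcp h)))) (<-≤-trans h< (≤-reflexive (sym (is-lcp g))))
      clash (inj₁ g<) (inj₂ h≤) = n≮0 (<-≤-trans g< (≤-reflexive (trans (sym (is-lcp h)) (vanish h≤))))
      clash (inj₂ g≤) (inj₁ h<) = n≮0 (<-≤-trans h< (≤-reflexive (trans (sym (is-lcp g)) (vanish g≤))))
      clash (inj₂ g≤) (inj₂ h≤) = both-top (vanish g≤) (vanish h≤)

-- Counting ones

infix 7 #_
#_ : Bool → ℕ
# b = if b then 1 else 0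

Σ<-mono : ∀ n {f g : Fin n → ℕ} → (∀ i → f i ≤ g i) → Σ< n f ≤ Σ< n g
Σ<-mono zero    f≤g = z≤n
Σ<-mono (suc n) f≤g = +-mono-≤ (f≤g zero) (Σ<-mono n (λ i → f≤g (suc i)))

Σ<-cong : ∀ n {f g : Fin n → ℕ} → (∀ i → f i ≡ g i) → Σ< n f ≡ Σ< n g
Σ<-cong zero    f≡g = refl
Σ<-cong (suc n) f≡g = cong₂ _+_ (f≡g zero) (Σ<-cong n (λ i → f≡g (suc i)))

Σ<-const : ∀ n c → Σ< n (λ _ → c) ≡ n * c
Σ<-const zero    c = refl
Σ<-const (suc n) c = cong (c +_) (Σ<-const n c)

Σ<-+ : ∀ n (f g : Fin n → ℕ) → Σ< n (λ i → f i + g i) ≡ Σ< n f + Σ< n g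
Σ<-+ zero    f g = refl
Σ<-+ (suc n) f g = trans (cong (f zero + g zero +_) (Σ<-+ n _ _)) (interchange +-commutativeSemigroup (f zero) (g zero) _ _)

Σ<-swap : ∀ m n (f : Fin m → Fin n → ℕ) →
          Σ< m (λ i → Σ< n (f i)) ≡ Σ< n (λ j → Σ< m (λ i → f i j))
Σ<-swap zero    n f = sym (trans (Σ<-const n 0) (*-zeroʳ n))
Σ<-swap (suc m) n f =
  trans (cong (Σ< n (f zero) +_) (Σ<-swap m n (λ i → f (suc i)))) (sym (Σ<-+ n (f zero) _))

term≤Σ< : ∀ n (f : Fin n → ℕ) i → f i ≤ Σ< n f
term≤Σ< (suc n) f zero    = m≤m+n (f zero) _
term≤Σ< (suc n) f (suc i) = ≤-trans (term≤Σ< n (λ i → f (suc i)) i) (m≤n+m _ (f zero))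

Σ<-prefix : ∀ n {k c} (f : Fin n → ℕ) → k ≤ n → (∀ i → toℕ i < k → c ≤ f i) → k * c ≤ Σ< n f
Σ<-prefix n       {zero}  f _         c≤f = z≤n
Σ<-prefix (suc n) {suc k} f (s≤s k≤n) c≤f =
  +-mono-≤ (c≤f zero (s≤s z≤n)) (Σ<-prefix n (λ i → f (suc i)) k≤n (λ i i<k → c≤f (suc i) (s≤s i<k)))

Σ<-≤-max : ∀ n (f : Fin (suc n) → ℕ) → Σ (Fin (suc n)) λ i → Σ< (suc n) f ≤ suc n * f i
Σ<-≤-max n f = proj₁ (maximum n f) , ≤-trans (Σ<-mono (suc n) (proj₂ (maximum n f))) (≤-reflexive (Σ<-const (suc n) _))
  where
    maximum : ∀ n (f : Fin (suc n) → ℕ) → Σ (Fin (suc n)) λ i → ∀ j → f j ≤ f i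
    maximum zero    f = zero , λ { zero → ≤-refl }
    maximum (suc n) f with maximum n (λ i → f (suc i))
    ... | i , max with ≤-total (f zero) (f (suc i))
    ...   | inj₁ f₀≤ = suc i , λ { zero → f₀≤ ; (suc j) → max j }
    ...   | inj₂ ≤f₀ = zero , λ { zero → ≤-refl ; (suc j) → ≤-trans (max j) ≤f₀ }

#-mono : ∀ {b c} → (b ≡ true → c ≡ true) → # b ≤ # c
#-mono {false}         _   = z≤n
#-mono {true}  {true}  _   = ≤-refl
#-mono {true}  {false} b⇒c with () ← b⇒c refl

count-none : ∀ n (f : Fin n → Bool) → (∀ i → f i ≢ true) → Σ< n (λ i → # f i) ≤ 0
count-none n f none = ≤-trans (Σ<-mono n (λ i → #-mono {c = false} (λ fi → ⊥-elim (none i fi))))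
                              (≤-reflexive (trans (Σ<-const n 0) (*-zeroʳ n)))

count-unique : ∀ n (f : Fin n → Bool) → (∀ i j → f i ≡ true → f j ≡ true → i ≡ j) →
               Σ< n (λ i → # f i) ≤ 1
count-unique zero    f unique = z≤n
count-unique (suc n) f unique with f zero in f₀
... | true  = s≤s (count-none n _ λ i fi → Fin.0≢1+n (unique zero (suc i) f₀ fi))
... | false = count-unique n _ λ i j fi fj → Fin.suc-injective (unique (suc i) (suc j) fi fj)

count-injective : ∀ {m n} (f : Fin n → Bool) (g : Fin m → Fin n) → Injective _≡_ _≡_ g →
                  (∀ i → f (g i) ≡ true) → m ≤ Σ< n (λ j → # f j)
count-injective {m} {n} f g g-inj fg = begin
  m                                              ≡⟨ trans (Σ<-const m 1) (*-identityʳ m) ⟨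
  Σ< m (λ i → 1)                                 ≤⟨ Σ<-mono m hit ⟩
  Σ< m (λ i → Σ< n (λ j → # does (g i Fin.≟ j))) ≡⟨ Σ<-swap m n _ ⟩
  Σ< n (λ j → Σ< m (λ i → # does (g i Fin.≟ j))) ≤⟨ Σ<-mono n once ⟩
  Σ< n (λ j → # f j)                             ∎
  where
    open ≤-Reasoning
    hit : ∀ i → 1 ≤ Σ< n (λ j → # does (g i Fin.≟ j))
    hit i = ≤-trans (≤-reflexive (cong #_ (sym (dec-true (g i Fin.≟ g i) refl))))
                    (term≤Σ< n (λ j → # does (g i Fin.≟ j)) (g i))
    once : ∀ j → Σ< m (λ i → # does (g i Fin.≟ j)) ≤ # f j
    once j with f j in fj
    ... | true  = count-unique m _ λ i i′ p p′ →
                    g-inj (trans (does-sound (g i Fin.≟ j) p) (sym (does-sound (g i′ Fin.≟ j) p′)))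
    ... | false = count-none m _ λ i p → false≢true (trans (sym fj) (trans (cong f (sym (does-sound (g i Fin.≟ j) p))) (fg i)))
      where
        false≢true : false ≢ true
        false≢true ()

-- The lower bound

n<2^[1+log₂n] : ∀ n → n < 2 ^ suc ⌊log₂ n ⌋
n<2^[1+log₂n] n = ≰⇒> λ 2^≤n →
  1+n≰n (≤-trans (≤-reflexive (sym (⌊log₂[2^n]⌋≡n (suc ⌊log₂ n ⌋)))) (⌊log₂⌋-mono-≤ 2^≤n))

2^log₂n≤n : ∀ n → 1 ≤ n → 2 ^ ⌊log₂ n ⌋ ≤ n
2^log₂n≤n n 1≤n = bound ⌊log₂ n ⌋ n 1≤n refl
  where
    bound : ∀ k n → 1 ≤ n → ⌊log₂ n ⌋ ≡ k → 2 ^ k ≤ n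
    bound zero    n 1≤n _  = 1≤n
    bound (suc k) 1 _   ()
    bound (suc k) n@(suc (suc _)) _ eq = begin
      2 ^ suc k            ≤⟨ *-monoʳ-≤ 2 (bound k ⌊ n /2⌋ (s≤s z≤n) (trans (⌊log₂⌊n/2⌋⌋≡⌊log₂n⌋∸1 n) (cong pred eq))) ⟩
      2 * ⌊ n /2⌋          ≡⟨ cong (⌊ n /2⌋ +_) (+-identityʳ ⌊ n /2⌋) ⟩
      ⌊ n /2⌋ + ⌊ n /2⌋    ≤⟨ +-monoʳ-≤ ⌊ n /2⌋ (⌊n/2⌋≤⌈n/2⌉ n) ⟩
      ⌊ n /2⌋ + ⌈ n /2⌉    ≡⟨ ⌊n/2⌋+⌈n/2⌉≡n n ⟩
      n                    ∎ where open ≤-Reasoning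

-- The matrix of the weights

decode : ∀ b m → Fin (b ^ m) → Vec (Fin b) m
decode b zero    _ = []
decode b (suc m) κ = proj₁ (remQuot {b} (b ^ m) κ) ∷ decode b m (proj₂ (remQuot {b} (b ^ m) κ))

decode-injective : ∀ b m {κ κ′} → decode b m κ ≡ decode b m κ′ → κ ≡ κ′
decode-injective b zero    {zero} {zero} _  = refl
decode-injective b (suc m) {κ} {κ′}      eq with ∷-injective eq
... | q≡ , r≡ = begin
  κ                                             ≡⟨ Fin.combine-remQuot {b} (b ^ m) κ ⟨
  uncurry Fin.combine (remQuot {b} (b ^ m) κ)   ≡⟨ cong₂ Fin.combine q≡ (decode-injective b m r≡) ⟩
  uncurry Fin.combine (remQuot {b} (b ^ m) κ′)  ≡⟨ Fin.combine-remQuot {b} (b ^ m) κ′ ⟩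
  κ′                                            ∎
  where open ≡-Reasoning

module WeightMatrix (b M : ℕ) .{{_ : NonZero M}} (q : ℕ) (fits : Weights.Fits b M (suc q) 1) (n : ℕ) where
  open Weights b M

  private
    L V : ℕ
    L = suc (q * 2)
    V = M ^ (suc q * b)
    W : Fin (b ^ suc q) → ℕ
    W κ = weight 1 (decode b (suc q) κ)

    edge? : (x y : Fin n) → Dec (Σ _ λ κ → toℕ x + toℕ y + suc (W κ) ≡ n)
    edge? x y = any? λ κ → toℕ x + toℕ y + suc (W κ) ≟ n

  weight-matrix : Matrix n n
  weight-matrix x y = does (edge? x y)

  weight-matrix-avoids : ¬ Contains (cross L {suc L} {suc (suc L)}) weight-matrix
  weight-matrix-avoids (r , c , r< , c< , edges) =
    no-cross q fits n x y κ x< y< on-edge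
    where
      row : ℕ → Fin (suc L)
      row i = fromℕ< (s≤s (m⊓n≤n i L))
      col : ℕ → Fin (suc (suc L))
      col j = fromℕ< (s≤s (m⊓n≤n j (suc L)))
      toℕ-row : ∀ {i} → i < suc L → toℕ (row i) ≡ i
      toℕ-row (s≤s i≤L) = trans (toℕ-fromℕ< _) (m≤n⇒m⊓n≡m i≤L)
      toℕ-col : ∀ {j} → j < suc (suc L) → toℕ (col j) ≡ j
      toℕ-col (s≤s j≤L) = trans (toℕ-fromℕ< _) (m≤n⇒m⊓n≡m j≤L)

      x y : ℕ → ℕ
      x i = toℕ (r (row i))
      y j = toℕ (c (col j))

      x< : ∀ {i j} → i < j → j < suc L → x i < x j
      x< i<j j< = r< _ _ (subst₂ _<_ (sym (toℕ-row (<-trans i<j j<))) (sym (toℕ-row j<)) i<j)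
      y< : ∀ {i j} → i < j → j < suc (suc L) → y i < y j
      y< i<j j< = c< _ _ (subst₂ _<_ (sym (toℕ-col (<-trans i<j j<))) (sym (toℕ-col j<)) i<j)

      witness : ∀ i j → Entry L (toℕ i) (toℕ j) → Σ _ λ κ → toℕ (r i) + toℕ (c j) + suc (W κ) ≡ n
      witness i j e = does-sound (edge? (r i) (c j)) (edges i j (dec-true (entry? L (toℕ i) (toℕ j)) e))

      tuple : ∀ i j → Dec (Entry L (toℕ i) (toℕ j)) → Vec (Fin b) (suc q)
      tuple i j (yes e) = decode b (suc q) (proj₁ (witness i j e))
      -- Outside the pattern any tuple will do. The one at the corner (0,0) is taken because `b`
      -- might be 0 here, so that no digit is at hand.
      tuple i j (no  _) = decode b (suc q) (proj₁ (witness zero zero (inj₁ (inj₁ (refl , inj₁ refl)))))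

      tuple-edge : ∀ i j e? → Entry L (toℕ i) (toℕ j) →
                   toℕ (r i) + toℕ (c j) + suc (weight 1 (tuple i j e?)) ≡ n
      tuple-edge i j (yes e) _ = proj₂ (witness i j e)
      tuple-edge i j (no ¬e) e = ⊥-elim (¬e e)

      κ : ℕ → ℕ → Vec (Fin b) (suc q)
      κ i j = tuple (row i) (col j) (entry? L (toℕ (row i)) (toℕ (col j)))

      on-edge : ∀ i j → i < suc L → j < suc (suc L) → Entry L i j →
                x i + y j + suc (weight 1 (κ i j)) ≡ n
      on-edge i j i< j< e = tuple-edge (row i) (col j) (entry? L (toℕ (row i)) (toℕ (col j)))
        (subst₂ (Entry L) (sym (toℕ-row i<)) (sym (toℕ-col j<)) e)

  -- All weights are below `V`, so in each of the first `n ∸ V` rows every tuple yields a position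
  -- within the matrix, and different tuples yield different ones by `weight-injective`.
  weight-matrix-ones : (n ∸ V) * b ^ suc q ≤ ones weight-matrix
  weight-matrix-ones = Σ<-prefix n (λ x → Σ< n (λ y → # weight-matrix x y)) (m∸n≤m n V) λ x x< →
    count-injective (weight-matrix x) (target x x<) (target-injective x x<) (on-target x x<)
    where
      W<V : ∀ κ → suc (W κ) ≤ V
      W<V κ = ≤-trans (s≤s (m≤m+n (W κ) _)) (weight-tail (decode b (suc q) κ) fits)

      room : ∀ x → toℕ {n} x < n ∸ V → ∀ κ → toℕ x + suc (W κ) ≤ n
      room x x< κ = begin
        toℕ x + suc (W κ)  ≤⟨ +-mono-≤ (<⇒≤ x<) (W<V κ) ⟩
        n ∸ V + V          ≡⟨ m∸n+n≡m (<⇒≤ (m<n∸o⇒o<n {o = V} x<)) ⟩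
        n                  ∎
        where
          open ≤-Reasoning
          m<n∸o⇒o<n : ∀ {m n o} → m < n ∸ o → o < n
          m<n∸o⇒o<n {o = o} m< = m∸n≢0⇒n<m λ eq → n≮0 (≤-trans m< (≤-reflexive eq))

      target : ∀ x → toℕ {n} x < n ∸ V → Fin (b ^ suc q) → Fin n
      target x x< κ = fromℕ< {n ∸ (toℕ x + suc (W κ))}
        (∸-monoʳ-< (≤-trans (s≤s z≤n) (m≤n+m (suc (W κ)) (toℕ x))) (room x x< κ))

      target-injective : ∀ x x< → Injective _≡_ _≡_ (target x x<)
      target-injective x x< {κ} {κ′} eq = decode-injective b (suc q) (weight-injective _ _ ≤-refl fits
        (suc-injective (+-cancelˡ-≡ (toℕ x) _ _ (∸-cancelˡ-≡ (room x x< κ) (room x x< κ′)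
          (trans (sym (toℕ-fromℕ< _)) (trans (cong toℕ eq) (toℕ-fromℕ< _)))))))

      on-target : ∀ x x< κ → weight-matrix x (target x x< κ) ≡ true
      on-target x x< κ = dec-true (edge? x (target x x< κ)) (κ , (begin
        toℕ x + toℕ (target x x< κ) + suc (W κ)          ≡⟨ cong (λ z → toℕ x + z + suc (W κ)) (toℕ-fromℕ< _) ⟩
        toℕ x + (n ∸ (toℕ x + suc (W κ))) + suc (W κ)    ≡⟨ shuffle (toℕ x) _ (suc (W κ)) ⟩
        toℕ x + suc (W κ) + (n ∸ (toℕ x + suc (W κ)))    ≡⟨ m+[n∸m]≡n (room x x< κ) ⟩
        n                                                ∎))
        where
          open ≡-Reasoning
          shuffle : ∀ a b c → a + b + c ≡ a + c + b
          shuffle = solve-∀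

-- Choice of the parameters

^-distribʳ-* : ∀ o m n → (m * n) ^ o ≡ m ^ o * n ^ o
^-distribʳ-* zero    m n = refl
^-distribʳ-* (suc o) m n = trans (cong (m * n *_) (^-distribʳ-* o m n)) (interchange *-commutativeSemigroup m n (m ^ o) (n ^ o))

-- At `ℓ = 3T`, with `T = (t + 1)²`, the left side is below `(T + 1)³ ≤ 2 ^ (3T)`; from there on
-- each step at most doubles it. In `lower-bound` this keeps `Q` below `log₂ n`.
[1+ℓ]T≤2^ℓ : ∀ t ℓ → 3 * (suc t * suc t) ≤ ℓ → suc ℓ * (suc t * suc t) ≤ 2 ^ ℓ
[1+ℓ]T≤2^ℓ t ℓ 3T≤ℓ = subst (λ ℓ → suc ℓ * T ≤ 2 ^ ℓ) (m∸n+n≡m 3T≤ℓ) (grow (ℓ ∸ 3 * T))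
  where
    open ≤-Reasoning
    T = suc t * suc t
    base : suc (3 * T) * T ≤ 2 ^ (3 * T)
    base = begin
      suc (3 * T) * T                                       ≤⟨ m≤m+n _ _ ⟩
      suc (3 * T) * T + (T * (T * T) + 2 * T + 1)           ≡⟨ cube T ⟩
      suc T ^ 3                                             ≤⟨ ^-monoˡ-≤ 3 (n<2^n T) ⟩
      (2 ^ T) ^ 3                                           ≡⟨ ^-*-assoc 2 T 3 ⟩
      2 ^ (T * 3)                                           ≡⟨ cong (2 ^_) (*-comm T 3) ⟩
      2 ^ (3 * T)                                           ∎
      where
        cube : ∀ T → suc (3 * T) * T + (T * (T * T) + 2 * T + 1) ≡ suc T * (suc T * (suc T * 1))
        cube = solve-∀
        n<2^n : ∀ n → n < 2 ^ n
        n<2^n zero    = s≤s z≤n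
        n<2^n (suc n) = begin-strict
          suc n            <⟨ +-mono-≤-< (m^n>0 2 n) (n<2^n n) ⟩
          2 ^ n + 2 ^ n    ≡⟨ cong (2 ^ n +_) (+-identityʳ (2 ^ n)) ⟨
          2 ^ suc n        ∎
    grow : ∀ j → suc (j + 3 * T) * T ≤ 2 ^ (j + 3 * T)
    grow zero    = base
    grow (suc j) = begin
      T + suc (j + 3 * T) * T                            ≤⟨ +-monoˡ-≤ _ (m≤m+n T _) ⟩
      suc (j + 3 * T) * T + suc (j + 3 * T) * T          ≡⟨ cong (suc (j + 3 * T) * T +_) (+-identityʳ _) ⟨
      2 * (suc (j + 3 * T) * T)                          ≤⟨ *-monoʳ-≤ 2 (grow j) ⟩
      2 ^ suc (j + 3 * T)                                ∎

-- The number `b ^ t` of tuples is made as large as `2V ≤ n` permits. Since `V = 2 ^ (b * Q)` with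
-- `Q` of order `ℓ`, this gives `b` of order `k / ℓ`, and at least half of the rows contain `b ^ t`
-- ones.
lower-bound : ∀ q → ExLowerBound (cross (suc (q * 2)) {suc q * 2} {suc (suc q * 2)}) (suc q)
-- The factor 2 pays for the lost rows, and `8t²` combines `k ≤ 2bQ` with `Q ≤ 4t²ℓ`. The threshold
-- makes `ℓ ≥ 3T`.
lower-bound q = 2 * (8 * (t * t)) ^ t , 2 ^ 2 ^ (3 * T) , λ n N≤n →
    let open At n N≤n in weight-matrix , weight-matrix-avoids , bound
  where
    t = suc q
    T = suc t * suc t
    module At (n : ℕ) (N≤n : 2 ^ 2 ^ (3 * T) ≤ n) where
      open ≤-Reasoning
      k = ⌊log₂ n ⌋
      ℓ = ⌊log₂ k ⌋
      -- Since `b ≤ 2 ^ (1 + ℓ)`, the first summand covers `b ^ t`; the summand 2 provides the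
      -- factor 4 that `Fits` demands at `ρ = 1`.
      s = suc ℓ * t + 2
      Q = s * t

      2^3T≤k : 2 ^ (3 * T) ≤ k
      2^3T≤k = subst (_≤ k) (⌊log₂[2^n]⌋≡n (2 ^ (3 * T))) (⌊log₂⌋-mono-≤ N≤n)

      3T≤ℓ : 3 * T ≤ ℓ
      3T≤ℓ = subst (_≤ ℓ) (⌊log₂[2^n]⌋≡n (3 * T)) (⌊log₂⌋-mono-≤ 2^3T≤k)

      1≤k : 1 ≤ k
      1≤k = ≤-trans (m^n>0 2 (3 * T)) 2^3T≤k

      1≤n : 1 ≤ n
      1≤n = ≤-trans (m^n>0 2 (2 ^ (3 * T))) N≤n

      Q<k : Q < k
      Q<k = begin
        suc Q                       ≤⟨ m≤m+n (suc Q) _ ⟩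
        suc Q + ℓ * (2 * t + 1)     ≡⟨ expand ℓ t ⟩
        suc ℓ * T                   ≤⟨ [1+ℓ]T≤2^ℓ t ℓ 3T≤ℓ ⟩
        2 ^ ℓ                       ≤⟨ 2^log₂n≤n k 1≤k ⟩
        k                           ∎
        where
          expand : ∀ ℓ t → suc ((suc ℓ * t + 2) * t) + ℓ * (2 * t + 1) ≡ suc ℓ * (suc t * suc t)
          expand = solve-∀

      instance
        Q≢0 : NonZero Q
        Q≢0 = m*n≢0 s t {{>-nonZero (≤-trans (s≤s z≤n) (m≤n+m 2 (suc ℓ * t)))}}
        M≢0 : NonZero (2 ^ s)
        M≢0 = m^n≢0 2 s

      b = (k ∸ 1) / Q

      1≤b : 1 ≤ b
      1≤b = m≥n⇒m/n>0 (∸-monoˡ-≤ 1 Q<k)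

      bQ<k : b * Q < k
      bQ<k = begin
        suc (b * Q)    ≤⟨ s≤s (m/n*n≤m (k ∸ 1) Q) ⟩
        suc (k ∸ 1)    ≡⟨ m+[n∸m]≡n 1≤k ⟩
        k              ∎

      k≤2bQ : k ≤ 2 * (b * Q)
      k≤2bQ = begin
        k                               ≡⟨ m+[n∸m]≡n 1≤k ⟨
        suc (k ∸ 1)                     ≡⟨ cong suc (m≡m%n+[m/n]*n (k ∸ 1) Q) ⟩
        suc ((k ∸ 1) % Q + b * Q)       ≤⟨ +-monoˡ-≤ (b * Q) (m%n<n (k ∸ 1) Q) ⟩
        Q + b * Q                       ≤⟨ +-monoˡ-≤ (b * Q) (m≤n*m Q b {{>-nonZero 1≤b}}) ⟩
        b * Q + b * Q                   ≡⟨ cong (b * Q +_) (+-identityʳ (b * Q)) ⟨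
        2 * (b * Q)                     ∎

      Q≤ : Q ≤ 4 * (t * t) * ℓ
      Q≤ = subst (λ ℓ → (suc ℓ * t + 2) * t ≤ 4 * (t * t) * ℓ) (m+[n∸m]≡n 1≤ℓ)
                 (≤-trans (m≤m+n _ _) (≤-reflexive (expand (ℓ ∸ 1) q)))
        where
          1≤ℓ : 1 ≤ ℓ
          1≤ℓ = ≤-trans (s≤s z≤n) 3T≤ℓ
          expand : ∀ ℓ q → (suc (suc ℓ) * suc q + 2) * suc q + (3 * ℓ * q + 3 * ℓ + 2 * q) * suc q
                           ≡ 4 * (suc q * suc q) * suc ℓ
          expand = solve-∀

      fits : Weights.Fits b (2 ^ s) t 1
      fits = Weights.fits-in (begin
        2 * (2 * b ^ t)               ≤⟨ *-monoʳ-≤ 2 (*-monoʳ-≤ 2 (^-monoˡ-≤ t b≤)) ⟩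
        2 * (2 * (2 ^ suc ℓ) ^ t)     ≡⟨ cong (λ z → 2 * (2 * z)) (^-*-assoc 2 (suc ℓ) t) ⟩
        2 ^ (2 + suc ℓ * t)           ≡⟨ cong (2 ^_) (+-comm 2 (suc ℓ * t)) ⟩
        2 ^ s                         ∎)
        where
          b≤ : b ≤ 2 ^ suc ℓ
          b≤ = ≤-trans (m/n≤m (k ∸ 1) Q) (≤-trans (m∸n≤m k 1) (<⇒≤ (n<2^[1+log₂n] k)))

      open WeightMatrix b (2 ^ s) q fits n public

      V = (2 ^ s) ^ (t * b)

      2V≤n : 2 * V ≤ n
      2V≤n = begin
        2 * (2 ^ s) ^ (t * b)    ≡⟨ cong (2 *_) (^-*-assoc 2 s (t * b)) ⟩
        2 ^ suc (s * (t * b))    ≡⟨ cong (λ e → 2 ^ suc e) (trans (sym (*-assoc s t b)) (*-comm Q b)) ⟩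
        2 ^ suc (b * Q)          ≤⟨ ^-monoʳ-≤ 2 bQ<k ⟩
        2 ^ k                    ≤⟨ 2^log₂n≤n n 1≤n ⟩
        n                        ∎

      n≤2[n∸V] : n ≤ 2 * (n ∸ V)
      n≤2[n∸V] = begin
        n              ≡⟨ m+n∸n≡m n n ⟨
        n + n ∸ n      ≤⟨ ∸-monoʳ-≤ (n + n) 2V≤n ⟩
        n + n ∸ 2 * V  ≡⟨ cong (_∸ 2 * V) (cong (n +_) (+-identityʳ n)) ⟨
        2 * n ∸ 2 * V  ≡⟨ *-distribˡ-∸ 2 n V ⟨
        2 * (n ∸ V)    ∎

      bound : n * k ^ t ≤ 2 * (8 * (t * t)) ^ t * ones weight-matrix * ℓ ^ t
      bound = begin
        n * k ^ t                                               ≤⟨ *-mono-≤ n≤2[n∸V] (^-monoˡ-≤ t (≤-trans k≤2bQ (*-monoʳ-≤ 2 (*-monoʳ-≤ b Q≤)))) ⟩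
        2 * (n ∸ V) * (2 * (b * (4 * (t * t) * ℓ))) ^ t          ≡⟨ cong (λ z → 2 * (n ∸ V) * z ^ t) (regroup b (t * t) ℓ) ⟩
        2 * (n ∸ V) * (8 * (t * t) * b * ℓ) ^ t                  ≡⟨ cong (2 * (n ∸ V) *_) powers ⟩
        2 * (n ∸ V) * ((8 * (t * t)) ^ t * b ^ t * ℓ ^ t)        ≡⟨ reorder (n ∸ V) ((8 * (t * t)) ^ t) (b ^ t) (ℓ ^ t) ⟩
        2 * (8 * (t * t)) ^ t * ((n ∸ V) * b ^ t) * ℓ ^ t        ≤⟨ *-monoˡ-≤ (ℓ ^ t) (*-monoʳ-≤ (2 * (8 * (t * t)) ^ t) weight-matrix-ones) ⟩
        2 * (8 * (t * t)) ^ t * ones weight-matrix * ℓ ^ t       ∎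
        where
          powers : (8 * (t * t) * b * ℓ) ^ t ≡ (8 * (t * t)) ^ t * b ^ t * ℓ ^ t
          powers = trans (^-distribʳ-* t (8 * (t * t) * b) ℓ)
                         (cong (_* ℓ ^ t) (^-distribʳ-* t (8 * (t * t)) b))
          regroup : ∀ b u ℓ → 2 * (b * (4 * u * ℓ)) ≡ 8 * u * b * ℓ
          regroup = solve-∀
          reorder : ∀ a c d e → 2 * a * (c * d * e) ≡ 2 * c * (a * d) * e
          reorder = solve-∀

-- The upper bound

ones-flip : ∀ {k l} (A : Matrix k l) → ones A ≡ ones (flip A)
ones-flip {k} {l} A = Σ<-swap k l λ i j → # A i j

keep : ∀ {k l} (A : Matrix k l) {P : Fin k → Fin l → Set} → (∀ i j → Dec (P i j)) → Matrix k l
keep A P? i j = A i j ∧ does (P? i j)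

module _ {k l} (A : Matrix k l) {P : Fin k → Fin l → Set} (P? : ∀ i j → Dec (P i j)) where

  keep⁻ : ∀ {i j} → keep A P? i j ≡ true → A i j ≡ true × P i j
  keep⁻ {i} {j} kept with A i j | P? i j
  keep⁻ refl | true | yes p = refl , p

  keep⁺ : ∀ {i j} → A i j ≡ true → P i j → keep A P? i j ≡ true
  keep⁺ {i} {j} Aij p with A i j | P? i j
  keep⁺ refl p | true | yes _ = refl
  keep⁺ refl p | true | no ¬p = ⊥-elim (¬p p)

ones-cover : ∀ {k l K} {A : Matrix k l} (B : Fin K → Matrix k l) →
             (∀ i j → A i j ≡ true → Σ (Fin K) λ κ → B κ i j ≡ true) →
             ones A ≤ Σ< K (λ κ → ones (B κ))
ones-cover {k} {l} {K} {A} B cover = begin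
  ones A                                              ≤⟨ Σ<-mono k (λ i → Σ<-mono l (λ j → covered i j)) ⟩
  Σ< k (λ i → Σ< l (λ j → Σ< K (λ κ → # B κ i j)))    ≡⟨ Σ<-cong k (λ i → Σ<-swap l K _) ⟩
  Σ< k (λ i → Σ< K (λ κ → Σ< l (λ j → # B κ i j)))    ≡⟨ Σ<-swap k K _ ⟩
  Σ< K (λ κ → ones (B κ))                             ∎
  where
    open ≤-Reasoning
    covered : ∀ i j → # A i j ≤ Σ< K (λ κ → # B κ i j)
    covered i j with A i j in Aij
    ... | false = z≤n
    ... | true  with cover i j Aij
    ...   | κ , Bκ = ≤-trans (≤-reflexive (cong #_ (sym Bκ))) (term≤Σ< K (λ κ → # B κ i j) κ)

ones-pigeonhole : ∀ {k l K} {A : Matrix k l} (B : Fin (suc K) → Matrix k l) →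
                  (∀ i j → A i j ≡ true → Σ (Fin (suc K)) λ κ → B κ i j ≡ true) →
                  Σ (Fin (suc K)) λ κ → ones A ≤ suc K * ones (B κ)
ones-pigeonhole {K = K} B cover with Σ<-≤-max K (λ κ → ones (B κ))
... | κ , max = κ , ≤-trans (ones-cover B cover) max

-- Successors in a row and dyadic scales

module _ {k l} (A : Matrix k l) where

  NextWithin : ℕ → Fin k → Fin l → Set
  NextWithin D x y = Σ (Fin l) λ z → toℕ y < toℕ z × toℕ z < toℕ y + D × A x z ≡ true

  nextWithin? : ∀ D x y → Dec (NextWithin D x y)
  nextWithin? D x y = any? λ z → (toℕ y <? toℕ z) ×-dec (toℕ z <? toℕ y + D) ×-dec (A x z ≟ᵇ true)

  -- Within a row of length `l` the distance bound `l` is vacuous: only the last one of each row is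
  -- dropped.
  continued : Matrix k l
  continued = keep A (nextWithin? l)

  ones-continued : ones A ≤ k + ones continued
  ones-continued = begin
    ones A                                                        ≤⟨ Σ<-mono k row ⟩
    Σ< k (λ i → 1 + Σ< l (λ j → # continued i j))                 ≡⟨ Σ<-+ k (λ _ → 1) _ ⟩
    Σ< k (λ i → 1) + ones continued                               ≡⟨ cong (_+ ones continued) (trans (Σ<-const k 1) (*-identityʳ k)) ⟩
    k + ones continued                                            ∎
    where
      open ≤-Reasoning
      final : Matrix k l
      final = keep A (λ i j → ¬? (nextWithin? l i j))

      later : ∀ {i j j′} → toℕ j < toℕ j′ → A i j′ ≡ true → NextWithin l i j
      later {j = j} {j′} j<j′ Aij′ = j′ , j<j′ , <-≤-trans (toℕ<n j′) (m≤n+m l (toℕ j)) , Aij′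

      final-unique : ∀ i j j′ → final i j ≡ true → final i j′ ≡ true → j ≡ j′
      final-unique i j j′ p p′ with keep⁻ A (λ i j → ¬? (nextWithin? l i j)) p | keep⁻ A (λ i j → ¬? (nextWithin? l i j)) p′
      ... | Aij , ¬next | Aij′ , ¬next′ with <-cmp (toℕ j) (toℕ j′)
      ...   | tri< j<j′ _ _ = ⊥-elim (¬next (later j<j′ Aij′))
      ...   | tri≈ _ j≡j′ _ = toℕ-injective j≡j′
      ...   | tri> _ _ j′<j = ⊥-elim (¬next′ (later j′<j Aij))

      split : ∀ i j → # A i j ≤ # final i j + # continued i j
      split i j with A i j | nextWithin? l i j
      ... | false | _     = z≤n
      ... | true  | yes _ = ≤-refl
      ... | true  | no  _ = ≤-refl

      row : ∀ i → Σ< l (λ j → # A i j) ≤ 1 + Σ< l (λ j → # continued i j)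
      row i = begin
        Σ< l (λ j → # A i j)                                           ≤⟨ Σ<-mono l (split i) ⟩
        Σ< l (λ j → # final i j + # continued i j)                     ≡⟨ Σ<-+ l _ _ ⟩
        Σ< l (λ j → # final i j) + Σ< l (λ j → # continued i j)        ≤⟨ +-monoˡ-≤ _ (count-unique l (final i) (final-unique i)) ⟩
        1 + Σ< l (λ j → # continued i j)                               ∎

-- The same scale bounds `next` strictly from above and `sparse` from below. Hence the successor in
-- `A` of a one of `A′` stops short of every column further right that shares a row of `A′` with the
-- column of that one.
record Refinement {k l} (A A′ : Matrix k l) : Set where
  field
    scale  : ℕ
    sub    : ∀ {x y} → A′ x y ≡ true → A x y ≡ true
    next   : ∀ {x y} → A′ x y ≡ true → NextWithin A scale x y
    sparse : ∀ {x y z} → A′ x y ≡ true → A′ x z ≡ true → toℕ y < toℕ z → toℕ y + scale ≤ toℕ z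

first-true : ∀ {P : ℕ → Set} → (∀ s → Dec (P s)) → ¬ P 0 → ∀ K → P K →
             Σ (Fin K) λ s → P (suc (toℕ s)) × ¬ P (toℕ s)
first-true P? ¬P₀ zero    P₀ = ⊥-elim (¬P₀ P₀)
first-true {P} P? ¬P₀ (suc K) PK with P? K
... | no ¬PK = Fin.fromℕ K , subst (λ s → P (suc s) × ¬ P s) (sym (Fin.toℕ-fromℕ K)) (PK , ¬PK)
... | yes PK′ with first-true P? ¬P₀ K PK′
...   | s , Ps = Fin.inject₁ s , subst (λ s → P (suc s) × ¬ P s) (sym (Fin.toℕ-inject₁ s)) Ps

-- Cut the line into blocks of length `D`. The distance `D` puts `z` in a later block than `y`, and
-- equal residues modulo 3 of the block numbers put it at least three blocks on, leaving two whole
-- blocks between.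
same-residue : ∀ {D y z} .{{_ : NonZero D}} → y + D ≤ z → (y / D) % 3 ≡ (z / D) % 3 → y + 2 * D ≤ z
same-residue {D} {y} {z} y+D≤z r≡ = begin
  y + 2 * D                      ≤⟨ +-monoˡ-≤ (2 * D) (<⇒≤ y<) ⟩
  D + u * D + 2 * D              ≡⟨ collect u D ⟩
  (3 + u) * D                    ≤⟨ *-monoˡ-≤ D 3+u≤v ⟩
  v * D                          ≤⟨ m/n*n≤m z D ⟩
  z                              ∎
  where
    open ≤-Reasoning
    u = y / D
    v = z / D
    collect : ∀ u D → D + u * D + 2 * D ≡ (3 + u) * D
    collect = solve-∀
    y< : y < D + u * D
    y< = subst (_< D + u * D) (sym (m≡m%n+[m/n]*n y D)) (+-monoˡ-< (u * D) (m%n<n y D))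
    u<v : u < v
    u<v = begin
      suc u            ≡⟨ m*n/n≡m (suc u) D ⟨
      suc u * D / D    ≤⟨ /-monoˡ-≤ D (≤-trans (+-monoʳ-≤ D (m/n*n≤m y D)) (≤-trans (≤-reflexive (+-comm D y)) y+D≤z)) ⟩
      v                ∎
    quotients : u / 3 < v / 3
    quotients = ≰⇒> λ v/3≤u/3 → <⇒≱ u<v (begin
      v                        ≡⟨ m≡m%n+[m/n]*n v 3 ⟩
      v % 3 + v / 3 * 3        ≤⟨ +-mono-≤ (≤-reflexive (sym r≡)) (*-monoˡ-≤ 3 v/3≤u/3) ⟩
      u % 3 + u / 3 * 3        ≡⟨ m≡m%n+[m/n]*n u 3 ⟨
      u                        ∎)
    3+u≤v : 3 + u ≤ v
    3+u≤v = begin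
      3 + u                          ≡⟨ cong (3 +_) (m≡m%n+[m/n]*n u 3) ⟩
      3 + (u % 3 + u / 3 * 3)        ≡⟨ shift (u % 3) (u / 3) ⟩
      u % 3 + suc (u / 3) * 3        ≤⟨ +-mono-≤ (≤-reflexive r≡) (*-monoˡ-≤ 3 quotients) ⟩
      v % 3 + v / 3 * 3              ≡⟨ m≡m%n+[m/n]*n v 3 ⟨
      v                              ∎
      where
        shift : ∀ r a → 3 + (r + a * 3) ≡ r + suc a * 3
        shift = solve-∀

-- Ones that are not last in their row are sorted by the dyadic interval from `2 ^ s` to
-- `2 ^ (s + 1)` that holds the distance to their successor, and the fullest class is kept. Its ones
-- are only known to be `2 ^ s` apart; to reach the scale `2 ^ (s + 1)`, the fullest of three
-- residue classes of blocks is kept in turn.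
refine : ∀ {n} (A : Matrix n n) → Σ (Matrix n n) λ A′ → Refinement A A′ ×
         ones A ≤ n + suc ⌊log₂ n ⌋ * (3 * ones A′)
refine {n} A = refined , refinement , (begin
  ones A                                              ≤⟨ ones-continued A ⟩
  n + ones (continued A)                              ≤⟨ +-monoʳ-≤ n (proj₂ best-scale) ⟩
  n + suc ⌊log₂ n ⌋ * ones (at-scale s)               ≤⟨ +-monoʳ-≤ n (*-monoʳ-≤ (suc ⌊log₂ n ⌋) (proj₂ best-residue)) ⟩
  n + suc ⌊log₂ n ⌋ * (3 * ones refined)              ∎)
  where
    open ≤-Reasoning

    AtScale : Fin (suc ⌊log₂ n ⌋) → Fin n → Fin n → Set
    AtScale s x y = NextWithin A (2 ^ suc (toℕ s)) x y × ¬ NextWithin A (2 ^ toℕ s) x y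

    atScale? : ∀ s x y → Dec (AtScale s x y)
    atScale? s x y = nextWithin? A (2 ^ suc (toℕ s)) x y ×-dec ¬? (nextWithin? A (2 ^ toℕ s) x y)

    at-scale : Fin (suc ⌊log₂ n ⌋) → Matrix n n
    at-scale s = keep A (atScale? s)

    best-scale = ones-pigeonhole at-scale λ x y c →
      let Axy , z , y<z , _ , Axz = keep⁻ A (nextWithin? A n) {x} {y} c
          s , scaled = first-true (λ s → nextWithin? A (2 ^ s) x y)
            (λ (z , y<z , z< , _) → <⇒≱ z< (≤-trans (≤-reflexive (+-comm (toℕ y) 1)) y<z))
            (suc ⌊log₂ n ⌋)
            (z , y<z , <-≤-trans (<-trans (toℕ<n z) (n<2^[1+log₂n] n)) (m≤n+m _ (toℕ y)) , Axz)
      in s , keep⁺ A (atScale? s) Axy scaled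
    s = proj₁ best-scale

    instance
      2^s≢0 : NonZero (2 ^ toℕ s)
      2^s≢0 = m^n≢0 2 (toℕ s)

    residue? : ∀ (ρ : Fin 3) (x y : Fin n) → Dec (toℕ ρ ≡ (toℕ y / 2 ^ toℕ s) % 3)
    residue? ρ x y = toℕ ρ ≟ (toℕ y / 2 ^ toℕ s) % 3

    best-residue = ones-pigeonhole (λ ρ → keep (at-scale s) (residue? ρ)) λ x y scaled →
      let r< = m%n<n (toℕ y / 2 ^ toℕ s) 3
      in fromℕ< r< , keep⁺ (at-scale s) (residue? (fromℕ< r<)) scaled (toℕ-fromℕ< r<)
    ρ = proj₁ best-residue

    refined : Matrix n n
    refined = keep (at-scale s) (residue? ρ)

    refinement : Refinement A refined
    refinement = record
      { scale  = 2 ^ suc (toℕ s)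
      ; sub    = λ a → proj₁ (keep⁻ A (atScale? s) (proj₁ (keep⁻ (at-scale s) (residue? ρ) a)))
      ; next   = λ a → proj₁ (proj₂ (keep⁻ A (atScale? s) (proj₁ (keep⁻ (at-scale s) (residue? ρ) a))))
      ; sparse = λ {x} {y} {z} a a′ y<z →
          let a₁ , r  = keep⁻ (at-scale s) (residue? ρ) a
              a′₁ , r′ = keep⁻ (at-scale s) (residue? ρ) a′
              Axy , _ , ¬near = keep⁻ A (atScale? s) a₁
              Axz , _ = keep⁻ A (atScale? s) a′₁
          in same-residue (≮⇒≥ λ z< → ¬near (z , y<z , z< , Axz)) (trans (sym r) r′)
      }

-- Partial copies of the pattern and the insertion of a line

From : ℕ → ℕ → ℕ → Set
From p K k = k ≡ 0 ⊎ (p ≤ k × k ≤ K)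

IncreasingOn : ∀ {n} → (ℕ → Set) → (ℕ → Fin n) → Set
IncreasingOn R f = ∀ i j → R i → R j → i < j → f i Fin.< f j

-- Only the rows in `R` and the columns in `C` are placed. The maps keep the indices of the full
-- pattern and are unconstrained elsewhere, so an insertion changes one value and renumbers nothing.
record Embeds (L : ℕ) (R C : ℕ → Set) {k l} (A : Matrix k l) : Set where
  constructor embeds
  field
    row   : ℕ → Fin k
    col   : ℕ → Fin l
    row<  : IncreasingOn R row
    col<  : IncreasingOn C col
    edges : ∀ i j → R i → C j → Entry L i j → A (row i) (col j) ≡ true

transpose : ∀ {L R C k l} {A : Matrix k l} → Embeds L R C A → Embeds L C R (flip A)
transpose (embeds r c r< c< edges) = embeds c r c< r< λ i j Ri Cj e → edges j i Cj Ri (swap e)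

insert-at : ∀ {n} → ℕ → Fin n → (ℕ → Fin n) → ℕ → Fin n
insert-at q z f k with k ≟ q
... | yes _ = z
... | no  _ = f k

From-suc : ∀ {q K k} → From q K k → k ≢ q → From (suc q) K k
From-suc (inj₁ k≡0)         k≢q = inj₁ k≡0
From-suc (inj₂ (q≤k , k≤K)) k≢q = inj₂ (≤∧≢⇒< q≤k (λ q≡k → k≢q (sym q≡k)) , k≤K)

insert-increasing : ∀ {n q K} (f : ℕ → Fin n) (z : Fin n) → 1 ≤ q → q < K →
                    IncreasingOn (From (suc q) K) f → f 0 Fin.< z → z Fin.< f (suc q) →
                    IncreasingOn (From q K) (insert-at q z f)
insert-increasing {q = q} {K} f z 1≤q q<K f< f₀<z z< i j Ri Rj i<j with i ≟ q | j ≟ q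
... | yes refl | yes refl = ⊥-elim (<-irrefl refl i<j)
... | yes refl | no  j≢q  with m≤n⇒m<n∨m≡n i<j
...   | inj₂ refl = z<
...   | inj₁ sq<j = <-trans z< (f< (suc q) j (inj₂ (≤-refl , q<K)) (From-suc Rj j≢q) sq<j)
insert-increasing f z 1≤q q<K f< f₀<z z< i j (inj₁ refl) Rj i<j | no i≢q | yes refl = f₀<z
insert-increasing f z 1≤q q<K f< f₀<z z< i j (inj₂ (q≤i , _)) Rj i<j | no i≢q | yes refl = ⊥-elim (<⇒≱ i<j q≤i)
insert-increasing f z 1≤q q<K f< f₀<z z< i j Ri Rj i<j | no i≢q | no j≢q =
  f< i j (From-suc Ri i≢q) (From-suc Rj j≢q) i<j

-- The new column q lies between columns 0 and q+1, which have a common row; so in the sparse matrix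
-- they are further apart than an entry of column 0 is from its successor in the full matrix.
insert-column : ∀ {L R q K n} {A A′ : Matrix n n} → parity L ≡ 1ℙ → R 0 → R L → 1 ≤ q → q < K →
                (∀ {i} → R i → Entry L i q → (i ≡ 0 × parity q ≡ 1ℙ) ⊎ (i ≡ L × parity q ≡ 0ℙ)) →
                Refinement A A′ → Embeds L R (From (suc q) K) A′ → Embeds L R (From q K) A
insert-column {L} {R} {q} {K} {n} {A} {A′} odd-L R₀ R_L 1≤q q<K unique ref (embeds r c r< c< edges) =
  build (parity q) refl
  where
    open Refinement ref

    0∈ : From (suc q) K 0
    0∈ = inj₁ refl

    suc-q∈ : From (suc q) K (suc q)
    suc-q∈ = inj₂ (≤-refl , q<K)

    -- `i` is the row that holds the one of column `q`, and `i′` is the other of rows 0 and `L`.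
    -- Parities alternate, so column `q + 1` has a one in row `i′`.
    attach : ∀ i i′ → R i → R i′ → (∀ {i″} → R i″ → Entry L i″ q → i″ ≡ i) →
             Entry L i 0 → Entry L i′ 0 → Entry L i′ (suc q) → Embeds L R (From q K) A
    attach i i′ Ri Ri′ only e₀ e₀′ e′ with next (edges i 0 Ri 0∈ e₀)
    ... | z , y<z , z< , Az =
      embeds r (insert-at q z c) r<
        (insert-increasing c z 1≤q q<K c< y<z
          (<-≤-trans z< (sparse (edges i′ 0 Ri′ 0∈ e₀′) (edges i′ (suc q) Ri′ suc-q∈ e′)
                                (c< 0 (suc q) 0∈ suc-q∈ (s≤s z≤n)))))
        new-edges
      where
        new-edges : ∀ i j → R i → From q K j → Entry L i j → A (r i) (insert-at q z c j) ≡ true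
        new-edges i″ j Ri″ Cj e with j ≟ q
        ... | yes refl = subst (λ i → A (r i) z ≡ true) (sym (only Ri″ e)) Az
        ... | no  j≢q  = sub (edges i″ j Ri″ (From-suc Cj j≢q) e)

    top-corner : Entry L 0 0
    top-corner = inj₁ (inj₁ (refl , inj₁ refl))
    bottom-corner : Entry L L 0
    bottom-corner = inj₁ (inj₂ (refl , refl))

    build : ∀ p → parity q ≡ p → Embeds L R (From q K) A
    build 0ℙ even = attach L 0 R_L R₀
      (λ Ri e → case unique Ri e of λ { (inj₁ (_ , odd)) → ⊥-elim (0ℙ≢1ℙ even odd) ; (inj₂ (i≡L , _)) → i≡L })
      bottom-corner top-corner (inj₁ (inj₁ (refl , inj₂ (parity-suc-even q even))))
    build 1ℙ odd = attach 0 L R₀ R_L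
      (λ Ri e → case unique Ri e of λ { (inj₁ (i≡0 , _)) → i≡0 ; (inj₂ (_ , even)) → ⊥-elim (0ℙ≢1ℙ even odd) })
      top-corner bottom-corner (inj₁ (inj₂ (refl , parity-suc-odd q odd)))

-- For `Q = Contains P` this unfolds to `ExUpperBound P e`. The general form admits partial copies
-- and transposed matrices.
Forced : (∀ {n} → Matrix n n → Set) → ℕ → Set
Forced Q e = Σ ℕ λ C → Σ ℕ λ N → ∀ n → N ≤ n → (A : Matrix n n) → ¬ Q A → ones A ≤ C * n * ⌊log₂ n ⌋ ^ e

forced-flip : ∀ {Q : ∀ {n} → Matrix n n → Set} {e} → Forced Q e → Forced (λ A → Q (flip A)) e
forced-flip (C , N , bound) = C , N , λ n N≤n A ¬Q →
  ≤-trans (≤-reflexive (ones-flip A)) (bound n N≤n (flip A) ¬Q)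

forced-mono : ∀ {Q Q′ : ∀ {n} → Matrix n n → Set} {e} → (∀ {n} {A : Matrix n n} → Q A → Q′ A) →
              Forced Q e → Forced Q′ e
forced-mono Q⇒Q′ (C , N , bound) = C , N , λ n N≤n A ¬Q′ → bound n N≤n A (λ q → ¬Q′ (Q⇒Q′ q))

-- One passage to a refinement costs one factor `log₂ n`. The threshold `2 + N` ensures
-- `1 ≤ log₂ n`, so that `1 + log₂ n` is at most twice `log₂ n`; hence 6 = 2 · 3, and the 1 pays for
-- the last ones of the rows.
forced-refine : ∀ {Q Q′ : ∀ {n} → Matrix n n → Set} {e} →
                (∀ {n} {A A′ : Matrix n n} → Refinement A A′ → Q A′ → Q′ A) →
                Forced Q e → Forced Q′ (suc e)
forced-refine {e = e} lift (C , N , bound) = 1 + 6 * C , 2 + N , λ n N≤n A ¬Q′ →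
  let A′ , ref , ones-A = refine A
      k = ⌊log₂ n ⌋
      1≤k : 1 ≤ k
      1≤k = ⌊log₂⌋-mono-≤ {2} (≤-trans (m≤m+n 2 N) N≤n)
      1≤kᵉ : 1 ≤ k ^ suc e
      1≤kᵉ = m^n>0 k {{>-nonZero 1≤k}} (suc e)
  in begin
    ones A                                            ≤⟨ ones-A ⟩
    n + suc k * (3 * ones A′)                         ≤⟨ +-mono-≤
      (≤-trans (≤-reflexive (sym (*-identityʳ n))) (*-monoʳ-≤ n 1≤kᵉ))
      (*-mono-≤ (≤-trans (+-monoˡ-≤ k 1≤k) (≤-reflexive (cong (k +_) (sym (+-identityʳ k)))))
        (*-monoʳ-≤ 3 (bound n (≤-trans (m≤n+m N 2) N≤n) A′ (λ q → ¬Q′ (lift ref q))))) ⟩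
    n * k ^ suc e + 2 * k * (3 * (C * n * k ^ e))     ≡⟨ collect n k C (k ^ e) ⟩
    (1 + 6 * C) * n * k ^ suc e                       ∎
  where
    open ≤-Reasoning
    collect : ∀ n k C p → n * (k * p) + 2 * k * (3 * (C * n * p)) ≡ (1 + 6 * C) * n * (k * p)
    collect = solve-∀

-- Building up the copy line by line

module UpperBound (L : ℕ) (odd-L : parity L ≡ 1ℙ) where

  1≤L : 1 ≤ L
  1≤L = n≢0⇒n>0 λ { refl → 0ℙ≢1ℙ refl odd-L }

  L∈ : ∀ {p} → p ≤ L → From p L L
  L∈ p≤L = inj₂ (p≤L , ≤-refl)

  -- Dropping the last one of each row and then the lowest remaining one of each column costs at
  -- most `2n`. A survivor has a one below it that in turn has a one to its right: the places (0,0),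
  -- (L,0) and (L,L+1). The pattern demands nothing at (0,L+1), as `L + 1` is even.
  base : Forced (Embeds L (From L L) (From (suc L) (suc L))) 0
  base = 2 , 0 , λ n _ A ¬embeds → begin
    ones A                                          ≤⟨ ones-continued A ⟩
    n + ones (continued A)                          ≡⟨ cong (n +_) (ones-flip (continued A)) ⟩
    n + ones (flip (continued A))                   ≤⟨ +-monoʳ-≤ n (ones-continued (flip (continued A))) ⟩
    n + (n + ones (continued (flip (continued A)))) ≤⟨ +-monoʳ-≤ n (+-monoʳ-≤ n (none A ¬embeds)) ⟩
    n + (n + 0)                                     ≡⟨ *-identityʳ (2 * n) ⟨
    2 * n * 1                                       ∎
    where
      open ≤-Reasoning
      corner : ∀ {n} (A : Matrix n n) {x y} → continued (flip (continued A)) y x ≡ true →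
               Embeds L (From L L) (From (suc L) (suc L)) A
      corner A {x} {y} kept with keep⁻ (flip (continued A)) (nextWithin? (flip (continued A)) _) {y} {x} kept
      ... | Axy , x′ , x<x′ , _ , Ax′y
        with keep⁻ A (nextWithin? A _) {x} {y} Axy | keep⁻ A (nextWithin? A _) {x′} {y} Ax′y
      ... | Axy , _ | Ax′y , y′ , y<y′ , _ , Ax′y′ =
        embeds (pick x x′) (pick y y′) (pick< x<x′ 1≤L) (pick< y<y′ (s≤s z≤n)) corner-edges
        where
          pick : ∀ {n} → Fin n → Fin n → ℕ → Fin n
          pick u v zero    = u
          pick u v (suc _) = v
          pick< : ∀ {n K} {u v : Fin n} → u Fin.< v → 1 ≤ K → IncreasingOn (From K K) (pick u v)
          pick< u<v _ zero    (suc j) _ _ _ = u<v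
          pick< u<v _ (suc i) (suc j) (inj₂ (K≤i , i≤K)) (inj₂ (K≤j , j≤K)) i<j = ⊥-elim (<⇒≱ i<j (≤-trans j≤K K≤i))
          corner-edges : ∀ i j → From L L i → From (suc L) (suc L) j → Entry L i j → A (pick x x′ i) (pick y y′ j) ≡ true
          corner-edges zero    zero    _ _ _ = Axy
          corner-edges (suc i) zero    _ _ _ = Ax′y
          corner-edges (suc i) (suc j) _ _ _ = Ax′y′
          corner-edges zero    (suc j) _ (inj₂ (L<j , j≤L)) e with refl ← ≤-antisym L<j j≤L | entry-top odd-L e
          ... | inj₂ odd = ⊥-elim (0ℙ≢1ℙ (parity-suc-odd L odd-L) odd)

      none : ∀ {n} (A : Matrix n n) → ¬ Embeds L (From L L) (From (suc L) (suc L)) A →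
             ones (continued (flip (continued A))) ≤ 0
      none {n} A ¬embeds = ≤-trans (Σ<-mono n λ y → count-none n _ λ x kept → ¬embeds (corner A kept))
                                   (≤-reflexive (trans (Σ<-const n 0) (*-zeroʳ n)))

  -- Columns go first, while rows 0 and `L` are the only ones present: then even column `L`, which
  -- may have many ones in the full pattern, has a single one to place.
  columns : ∀ s → s ≤ L → Forced (Embeds L (From L L) (From (suc L ∸ s) (suc L))) s
  columns zero    _   = base
  columns (suc s) s<L = forced-refine {e = s}
    (λ {_} {_} {A′} ref emb → insert-column odd-L (inj₁ refl) (L∈ ≤-refl) (m<n⇒0<n∸m s<L) (s≤s (m∸n≤m L s)) unique ref
                   (subst (λ p → Embeds L (From L L) (From p (suc L)) A′) (+-∸-assoc 1 (<⇒≤ s<L)) emb))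
    (columns s (<⇒≤ s<L))
    where
      q = L ∸ s
      unique : ∀ {i} → From L L i → Entry L i q → (i ≡ 0 × parity q ≡ 1ℙ) ⊎ (i ≡ L × parity q ≡ 0ℙ)
      unique (inj₁ refl) e with entry-top odd-L e
      ... | inj₁ q≡0 = ⊥-elim (<⇒≢ (m<n⇒0<n∸m s<L) (sym q≡0))
      ... | inj₂ odd = inj₁ (refl , odd)
      unique (inj₂ (L≤i , i≤L)) e with refl ← ≤-antisym i≤L L≤i = inj₂ (refl , entry-bottom odd-L e)

  -- The matrix is transposed so that `insert-column` inserts rows. All columns are present by now,
  -- but a row strictly between 0 and `L` has a single one in the full pattern. The `L ∸ 1`
  -- insertions bring the exponent to `2L - 1 = 4t - 3`.
  rows : ∀ s → s < L → Forced (Embeds L (From 1 (suc L)) (From (L ∸ s) L)) (s + L)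
  rows zero    _     = forced-mono {e = L} transpose
    (subst (λ p → Forced (λ A → Embeds L (From L L) (From p (suc L)) (flip A)) L) (m+n∸n≡m 1 L)
      (forced-flip {e = L} (columns L ≤-refl)))
  rows (suc s) 1+s<L = forced-refine {e = s + L}
    (λ {_} {_} {A′} ref emb → insert-column odd-L (inj₁ refl) (inj₂ (1≤L , n≤1+n L)) (m<n⇒0<n∸m 1+s<L) q<L unique ref
                   (subst (λ p → Embeds L (From 1 (suc L)) (From p L) A′) (+-∸-assoc 1 (<⇒≤ 1+s<L)) emb))
    (rows s (<⇒≤ 1+s<L))
    where
      q = L ∸ suc s
      q<L : q < L
      q<L = ∸-monoʳ-< (s≤s z≤n) (<⇒≤ 1+s<L)
      unique : ∀ {i} → From 1 (suc L) i → Entry L i q → (i ≡ 0 × parity q ≡ 1ℙ) ⊎ (i ≡ L × parity q ≡ 0ℙ)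
      unique _ e = entry-interior (λ q≡0 → <⇒≢ (m<n⇒0<n∸m 1+s<L) (sym q≡0)) (<⇒≢ q<L) (swap e)

  everything : Forced (Embeds L (From 1 L) (From 1 (suc L))) (L ∸ 1 + L)
  everything = forced-mono {e = L ∸ 1 + L} transpose (forced-flip {e = L ∸ 1 + L}
    (subst (λ p → Forced (Embeds L (From 1 (suc L)) (From p L)) (L ∸ 1 + L)) (m∸[m∸n]≡n 1≤L)
      (rows (L ∸ 1) (∸-monoʳ-< (s≤s z≤n) 1≤L))))

  contains : ∀ {n} {A : Matrix n n} → Embeds L (From 1 L) (From 1 (suc L)) A →
             Contains (cross L {suc L} {suc (suc L)}) A
  contains (embeds r c r< c< edges) =
    (λ i → r (toℕ i)) , (λ j → c (toℕ j)) ,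
    (λ i j → r< (toℕ i) (toℕ j) (member i) (member j)) ,
    (λ i j → c< (toℕ i) (toℕ j) (member i) (member j)) ,
    λ i j Xij → edges (toℕ i) (toℕ j) (member i) (member j) (does-sound (entry? L _ _) Xij)
    where
      member : ∀ {K} (i : Fin (suc K)) → From 1 K (toℕ i)
      member zero    = inj₁ refl
      member (suc i) = inj₂ (s≤s z≤n , toℕ<n i)

  upper-bound : ExUpperBound (cross L {suc L} {suc (suc L)}) (L ∸ 1 + L)
  upper-bound = forced-mono {e = L ∸ 1 + L} contains everything
theorem1 : (t : ℕ) → 2 ≤ t →
    Σ (Matrix (2 * t) (suc (2 * t))) λ X →
    Acyclic X × ExLowerBound X t × ExUpperBound X (4 * t ∸ 3)
theorem1 t@(suc q) _ =
  -- The size `suc L` computes to `t * 2`, whereas the statement has `2 * t`.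
  subst (λ k → Σ (Matrix k (suc k)) λ X → Acyclic X × ExLowerBound X t × ExUpperBound X (4 * t ∸ 3))
    (*-comm t 2)
    (cross L , acyclic odd , lower-bound q , subst (ExUpperBound (cross L)) exponents
      (UpperBound.upper-bound L odd))
  where
    L = suc (q * 2)
    odd = parity-odd q
    exponents : L ∸ 1 + L ≡ 4 * t ∸ 3
    exponents = sym (trans (cong (_∸ 3) (expand q)) (m+n∸m≡n 3 (q * 2 + L)))
      where
        expand : ∀ q → 4 * suc q ≡ 3 + (q * 2 + suc (q * 2))
        expand = solve-∀
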